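{- If a hypersequent $G$ has a derivation in $\mathbf{HMR}$, then it has a CAN-free derivation in $\mathbf{HMR}$.
   Context: Terms. Fix a countable set of variables $x,y,\dots$. Terms (in negation normal form) are generated by $A ::= x \mid \overline{x} \mid 0 \mid 1 \mid \overline{1} \mid A+A \mid rA \mid A\sqcup A \mid A\sqcap A \mid \Diamond A$ with $r\in\mathbb{R}_{>0}$. Negation: $\overline{x}$ for $x$, $\overline{\overline{x}}=x$, $\overline{0}=0$, $\overline 1$ for $1$, $\overline{\overline{1}}=1$, $\overline{A+B}=\overline A+\overline B$, $\overline{rA}=r\overline A$, $\overline{A\sqcup B}=\overline A\sqcap\overline B$, $\overline{A\sqcap B}=\overline A\sqcup\overline B$, $\overline{\Diamond A}=\Diamond\overline A$. A weighted term is $r.A$ ($r>0$); a sequent $\vdash\Gamma$ has $\Gamma$ a finite (possibly empty) multiset of weighted terms; a hypersequent is a nonempty finite multiset of sequents $\vdash\Gamma_1\mid\cdots\mid\vdash\Gamma_n$; $G\mid\vdash\Gamma$ adds a sequent. For a finite (possibly empty) sequence $\vec r=(r_1,\dots,r_n)$ of positive reals, $\vec r.A$ is the multiset $r_1.A,\dots,r_n.A$, $\sum\vec r=r_1+\dots+r_n$, $s\vec r=(sr_1,\dots,sr_n)$; $s.\Gamma$ multiplies all weights by $s>0$; if $\Gamma=r_1.A_1,\dots,r_n.A_n$ then $\Diamond\Gamma=r_1.\Diamond A_1,\dots,r_n.\Diamond A_n$. The calculus $\mathbf{HMR}$ has the rules: INIT: $\vdash$ with no premises. W: from $G$ infer $G\mid\vdash\Gamma$.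 C: from $G\mid\vdash\Gamma\mid\vdash\Gamma$ infer $G\mid\vdash\Gamma$. S: from $G\mid\vdash\Gamma_1,\Gamma_2$ infer $G\mid\vdash\Gamma_1\mid\vdash\Gamma_2$. M: from $G\mid\vdash\Gamma_1$ and $G\mid\vdash\Gamma_2$ infer $G\mid\vdash\Gamma_1,\Gamma_2$. T: for $r>0$, from $G\mid\vdash r.\Gamma$ infer $G\mid\vdash\Gamma$. ID: if $\sum\vec r=\sum\vec s$, from $G\mid\vdash\Gamma$ infer $G\mid\vdash\Gamma,\vec r.x,\vec s.\overline{x}$ ($x$ a variable). 0: from $G\mid\vdash\Gamma$ infer $G\mid\vdash\Gamma,\vec r.0$. $+$: from $G\mid\vdash\Gamma,\vec r.A,\vec r.B$ infer $G\mid\vdash\Gamma,\vec r.(A+B)$. $\times$: from $G\mid\vdash\Gamma,(s\vec r).A$ infer $G\mid\vdash\Gamma,\vec r.(sA)$. $\sqcup$: from $G\mid\vdash\Gamma,\vec r.A\mid\vdash\Gamma,\vec r.B$ infer $G\mid\vdash\Gamma,\vec r.(A\sqcup B)$. $\sqcap$: from $G\mid\vdash\Gamma,\vec r.A$ and $G\mid\vdash\Gamma,\vec r.B$ infer $G\mid\vdash\Gamma,\vec r.(A\sqcap B)$. CAN: if $\sum\vec r=\sum\vec s$, from $G\mid\vdash\Gamma,\vec s.A,\vec r.\overline A$ infer $G\mid\vdash\Gamma$. 1: if $\sum\vec r\geq\sum\vec s$, from $G\mid\vdash\Gamma$ infer $G\mid\vdash\Gamma,\vec r.1,\vec s.\overline{1}$.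 $\Diamond$: if $\sum\vec r\geq\sum\vec s$, from the single-sequent hypersequent $\vdash\Gamma,\vec r.1,\vec s.\overline 1$ infer the single-sequent hypersequent $\vdash\Diamond\Gamma,\vec r.1,\vec s.\overline 1$. A derivation is a finite tree of rule instances whose leaves are INIT; it is CAN-free if it contains no instance of CAN. -}

module Defs where

open import Data.Nat using (ℕ)
open import Data.Bool using (Bool; true; false)
open import Data.List using (List; []; _∷_; _++_; map; foldr)
open import Data.Product using (Σ; ∃; _×_; _,_)
open import Relation.Nullary using (¬_)
open import Relation.Binary.PropositionalEquality using (_≡_)
open import Relation.Binary.Definitions using (Decidable)
open import Relation.Binary.Structures using (IsTotalOrder)
open import Algebra.Structures using (IsCommutativeRing)
open import Data.List.Relation.Binary.Permutation.Propositional using (_↭_)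

-- The real numbers, given axiomatically as a (Dedekind-)complete
-- ordered field.  Every such structure is isomorphic to ℝ, so
-- quantifying over all of them is the same as working with ℝ.
-- (Decidability of ≤ holds classically for ℝ; the paper is classical.)

record Reals : Set₁ where
  infixl 6 _+_
  infixl 7 _*_
  infix 4 _≤_ _<_
  field
    ℝ     : Set
    _+_   : ℝ → ℝ → ℝ
    _*_   : ℝ → ℝ → ℝ
    -_    : ℝ → ℝ
    0ℝ    : ℝ
    1ℝ    : ℝ
    _≤_   : ℝ → ℝ → Set
    isCommutativeRing : IsCommutativeRing _≡_ _+_ _*_ -_ 0ℝ 1ℝ
    0≢1   : ¬ (0ℝ ≡ 1ℝ)
    inverse : ∀ x → ¬ (x ≡ 0ℝ) → ∃ λ y → x * y ≡ 1ℝ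
    isTotalOrder : IsTotalOrder _≡_ _≤_
    _≤?_  : Decidable _≤_
    +-mono-≤ : ∀ {x y} z → x ≤ y → x + z ≤ y + z
    *-nonneg : ∀ {x y} → 0ℝ ≤ x → 0ℝ ≤ y → 0ℝ ≤ x * y
    complete : (P : ℝ → Set) → ∃ P → (∃ λ b → ∀ x → P x → x ≤ b) →
               ∃ λ s → (∀ x → P x → x ≤ s) × (∀ b → (∀ x → P x → x ≤ b) → s ≤ b)

  _<_ : ℝ → ℝ → Set
  x < y = (x ≤ y) × ¬ (x ≡ y)

  field
    *-pos : ∀ {x y} → 0ℝ < x → 0ℝ < y → 0ℝ < x * y

module HMR (R : Reals) where
  open Reals R

  record Pos : Set where
    constructor pos
    field
      val   : ℝ
      .isPos : 0ℝ < val
  open Pos public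

  _·ᵖ_ : Pos → Pos → Pos
  pos a p ·ᵖ pos b q = pos (a * b) (*-pos p q)

  -- terms in negation normal form; variables are natural numbers
  infixl 6 _⊕_
  data Term : Set where
    var   : ℕ → Term
    covar : ℕ → Term
    𝟘     : Term
    𝟙     : Term
    𝟙̄     : Term
    _⊕_   : Term → Term → Term
    _⊙_   : Pos → Term → Term
    _⊔_   : Term → Term → Term
    _⊓_   : Term → Term → Term
    ◇     : Term → Term

  neg : Term → Term
  neg (var x)   = covar x
  neg (covar x) = var x
  neg 𝟘         = 𝟘
  neg 𝟙         = 𝟙̄
  neg 𝟙̄         = 𝟙
  neg (A ⊕ B)   = neg A ⊕ neg B
  neg (r ⊙ A)   = r ⊙ neg A
  neg (A ⊔ B)   = neg A ⊓ neg B
  neg (A ⊓ B)   = neg A ⊔ neg B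
  neg (◇ A)     = ◇ (neg A)

  -- weighted terms, sequents (multisets as lists up to permutation),
  -- hypersequents (multisets of sequents as lists up to permutation)
  WTerm : Set
  WTerm = Pos × Term

  Sequent : Set
  Sequent = List WTerm

  Hypersequent : Set
  Hypersequent = List Sequent

  _∙_ : List Pos → Term → Sequent
  rs ∙ A = map (λ r → r , A) rs

  Σ⃗ : List Pos → ℝ
  Σ⃗ = foldr (λ r acc → val r + acc) 0ℝ

  scaleS : Pos → Sequent → Sequent
  scaleS s = map (λ { (r , A) → (s ·ᵖ r) , A })

  scaleV : Pos → List Pos → List Pos
  scaleV s = map (s ·ᵖ_)

  ◇S : Sequent → Sequent
  ◇S = map (λ { (r , A) → r , ◇ A })

  -- Derivations.  The index b says whether CAN may be used:
  -- Deriv true G  = G has an HMR derivation,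
  -- Deriv false G = G has a CAN-free HMR derivation.
  -- The hypersequent "G | ⊢ Γ" is  Γ ∷ G  (G possibly empty);
  -- the multiset structure is captured by the two exchange rules.
  data Deriv : Bool → Hypersequent → Set where
    exH  : ∀ {b G G'} → G ↭ G' → Deriv b G → Deriv b G'
    exS  : ∀ {b G Γ Γ'} → Γ ↭ Γ' → Deriv b (Γ ∷ G) → Deriv b (Γ' ∷ G)
    INIT : ∀ {b} → Deriv b ([] ∷ [])
    W    : ∀ {b G Γ} → Deriv b G → Deriv b (Γ ∷ G)
    C    : ∀ {b G Γ} → Deriv b (Γ ∷ Γ ∷ G) → Deriv b (Γ ∷ G)
    S    : ∀ {b G Γ₁ Γ₂} → Deriv b ((Γ₁ ++ Γ₂) ∷ G) → Deriv b (Γ₁ ∷ Γ₂ ∷ G)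
    M    : ∀ {b G Γ₁ Γ₂} → Deriv b (Γ₁ ∷ G) → Deriv b (Γ₂ ∷ G) →
           Deriv b ((Γ₁ ++ Γ₂) ∷ G)
    T    : ∀ {b G Γ} (r : Pos) → Deriv b (scaleS r Γ ∷ G) → Deriv b (Γ ∷ G)
    ID   : ∀ {b G Γ} (x : ℕ) (rs ss : List Pos) → Σ⃗ rs ≡ Σ⃗ ss →
           Deriv b (Γ ∷ G) →
           Deriv b ((Γ ++ (rs ∙ var x) ++ (ss ∙ covar x)) ∷ G)
    ZERO : ∀ {b G Γ} (rs : List Pos) → Deriv b (Γ ∷ G) →
           Deriv b ((Γ ++ (rs ∙ 𝟘)) ∷ G)
    PLUS : ∀ {b G Γ A B} (rs : List Pos) →
           Deriv b ((Γ ++ (rs ∙ A) ++ (rs ∙ B)) ∷ G) →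
           Deriv b ((Γ ++ (rs ∙ (A ⊕ B))) ∷ G)
    TIMES : ∀ {b G Γ A} (s : Pos) (rs : List Pos) →
           Deriv b ((Γ ++ (scaleV s rs ∙ A)) ∷ G) →
           Deriv b ((Γ ++ (rs ∙ (s ⊙ A))) ∷ G)
    JOIN : ∀ {b G Γ A B} (rs : List Pos) →
           Deriv b ((Γ ++ (rs ∙ A)) ∷ (Γ ++ (rs ∙ B)) ∷ G) →
           Deriv b ((Γ ++ (rs ∙ (A ⊔ B))) ∷ G)
    MEET : ∀ {b G Γ A B} (rs : List Pos) →
           Deriv b ((Γ ++ (rs ∙ A)) ∷ G) →
           Deriv b ((Γ ++ (rs ∙ B)) ∷ G) →
           Deriv b ((Γ ++ (rs ∙ (A ⊓ B))) ∷ G)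
    CAN  : ∀ {G Γ} (A : Term) (rs ss : List Pos) → Σ⃗ rs ≡ Σ⃗ ss →
           Deriv true ((Γ ++ (ss ∙ A) ++ (rs ∙ neg A)) ∷ G) →
           Deriv true (Γ ∷ G)
    ONE  : ∀ {b G Γ} (rs ss : List Pos) → Σ⃗ ss ≤ Σ⃗ rs →
           Deriv b (Γ ∷ G) →
           Deriv b ((Γ ++ (rs ∙ 𝟙) ++ (ss ∙ 𝟙̄)) ∷ G)
    DIA  : ∀ {b Γ} (rs ss : List Pos) → Σ⃗ ss ≤ Σ⃗ rs →
           Deriv b ((Γ ++ (rs ∙ 𝟙) ++ (ss ∙ 𝟙̄)) ∷ []) →
           Deriv b ((◇S Γ ++ (rs ∙ 𝟙) ++ (ss ∙ 𝟙̄)) ∷ [])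

  Derivable : Hypersequent → Set
  Derivable = Deriv true

  CANFreeDerivable : Hypersequent → Set
  CANFreeDerivable = Deriv false

{-# OPTIONS --safe #-}
module Submission where

-- Cut-free completeness for a notion of validity that is visibly closed under
-- CAN. A term denotes, for every strategy choosing a side at each ⊓, a convex
-- cone of weighted sequents of atoms: ⊔ lets a weight be split between the two
-- sides, + adds, and a hypersequent is treated as the ⊔ of its components. It is
-- valid if against each strategy some nonzero combination is good, i.e. its
-- variables cancel, its 1's outweigh its negated 1's, and the premise that the
-- ◇ rule would need is itself valid. Two witnesses can be rescaled and added,
-- which gives M and the invertibility of ⊔; with it, CAN follows by induction
-- on the cancelled term, the atomic cases being immediate since removing a
-- balanced pair of atoms keeps a sequent good. Conversely, inverting the logical
-- rules reduces a valid hypersequent to atoms, where a good combination is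
-- derived by ID and ◇ and spread over the components by S, T and W.

open import Defs
open import Algebra.Bundles using (CommutativeRing; CommutativeMonoid; CommutativeSemigroup)
import Algebra.Properties.CommutativeSemigroup as CSP
import Algebra.Properties.Ring as RingP
open import Data.Bool using (false)
open import Data.Empty using (⊥-elim; ⊥-elim-irr)
open import Data.List using (List; []; _∷_; _++_; map)
open import Data.List.Properties using (++-assoc; ++-identityʳ; map-++)
open import Data.List.Relation.Binary.Permutation.Propositional
  using (_↭_; ↭-refl; ↭-sym; ↭-trans; prep; swap)
open import Data.List.Relation.Binary.Permutation.Propositional.Properties
  using (++-comm; ++⁺ʳ; ++⁺ˡ; map⁺; shift; shifts; All-resp-↭)
open import Data.List.Relation.Unary.All using (All; []; _∷_)
import Data.List.Relation.Unary.All as All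
import Data.List.Relation.Unary.All.Properties as All
open import Data.Maybe using (Maybe; just; nothing)
open import Data.Nat using (ℕ; zero; suc; _≟_)
import Data.Nat as ℕ
import Data.Nat.Properties as ℕ
open import Data.Product using (∃; _×_; _,_; proj₁; proj₂)
open import Data.Sum using (_⊎_; inj₁; inj₂)
open import Data.Unit using (⊤; tt)
open import Relation.Nullary using (¬_; yes; no)
open import Relation.Binary.Structures using (IsTotalOrder)
open import Relation.Binary.PropositionalEquality
  using (_≡_; refl; sym; trans; cong; cong₂; subst; subst₂; isEquivalence; module ≡-Reasoning)

-- The obstacle is that a strategy answers every occurrence of ⊓ separately. When one occurrence of
-- a term or context becomes two, as in splitting a weight r + s or inverting ⊔, the two copies may
-- be answered differently, whereas the hypothesis handles one answer at a time. It is therefore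
-- applied once per answer, and the two witnesses are mixed. Each witness comes with its own
-- weights, so the mixing coefficients must be chosen to make the weights fit together again;
-- products of the weights at hand suffice. This is why the cones record weights and why they must
-- be convex. Goodness has to survive the mixing too, and it refers to the validity of a ◇ premise.
-- Hence validity on one level must itself be closed under addition, scaling and merging before the
-- next level can use it.

module CANElimination (R : Reals) where
  open Reals R
  open HMR R

  ℝ-ring : CommutativeRing _ _
  ℝ-ring = record { isCommutativeRing = isCommutativeRing }
  open CommutativeRing ℝ-ring using
    ( +-assoc; +-comm; +-identityˡ; +-identityʳ; -‿inverseˡ; -‿inverseʳ
    ; *-assoc; *-comm; *-identityˡ; *-identityʳ; distribˡ; distribʳ; zeroˡ; zeroʳ
    ; ring)
  open RingP ring using (-0#≈0#; -‿distribˡ-*; -‿distribʳ-*; -‿involutive)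
  open IsTotalOrder isTotalOrder using (antisym; total)
    renaming (refl to ≤-refl; trans to ≤-trans; reflexive to ≤-reflexive)

  -- Positive reals

  +-mono₂-≤ : ∀ {a b c d} → a ≤ b → c ≤ d → a + c ≤ b + d
  +-mono₂-≤ {a} {b} {c} {d} p q = ≤-trans (+-mono-≤ c p)
    (subst₂ _≤_ (+-comm c b) (+-comm d b) (+-mono-≤ b q))

  +-nonneg : ∀ {a b} → 0ℝ ≤ a → 0ℝ ≤ b → 0ℝ ≤ a + b
  +-nonneg p q = subst (_≤ _) (+-identityˡ 0ℝ) (+-mono₂-≤ p q)

  a≤0⇒0≤-a : ∀ {a} → a ≤ 0ℝ → 0ℝ ≤ - a
  a≤0⇒0≤-a {a} p = subst₂ _≤_ (-‿inverseʳ a) (+-identityˡ (- a)) (+-mono-≤ (- a) p)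

  0≤-a⇒a≤0 : ∀ {a} → 0ℝ ≤ - a → a ≤ 0ℝ
  0≤-a⇒a≤0 {a} p = subst₂ _≤_ (+-identityˡ a) (-‿inverseˡ a) (+-mono-≤ a p)

  +-pos : ∀ {a b} → 0ℝ < a → 0ℝ < b → 0ℝ < a + b
  +-pos {a} {b} (p , p≢) (q , _) = +-nonneg p q ,
    λ e → p≢ (antisym p (subst (a ≤_) (sym e)
      (subst (_≤ a + b) (+-identityʳ a) (+-mono₂-≤ ≤-refl q))))

  0<1 : 0ℝ < 1ℝ
  0<1 = 0≤1 , 0≢1
    where
    0≤1 : 0ℝ ≤ 1ℝ
    0≤1 with total 0ℝ 1ℝ
    ... | inj₁ p = p
    ... | inj₂ p = subst (0ℝ ≤_) eq (*-nonneg (a≤0⇒0≤-a p) (a≤0⇒0≤-a p))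
      where
      eq : - 1ℝ * - 1ℝ ≡ 1ℝ
      eq = trans (sym (-‿distribˡ-* 1ℝ (- 1ℝ)))
        (trans (cong -_ (*-identityˡ (- 1ℝ))) (-‿involutive 1ℝ))

  -- The positivity proof stored in `Pos` is irrelevant and can only be used to refute; the usable
  -- proof comes from deciding the inequality.
  val-nonneg : ∀ r → 0ℝ ≤ val r
  val-nonneg (pos a p) with 0ℝ ≤? a
  ... | yes q = q
  ... | no ¬q = ⊥-elim-irr (¬q (proj₁ p))

  val-≢0 : ∀ r → ¬ (val r ≡ 0ℝ)
  val-≢0 (pos a p) e = ⊥-elim-irr (proj₂ p (sym e))

  pos-≡ : ∀ {r s} → val r ≡ val s → r ≡ s
  pos-≡ refl = refl

  infixl 6 _+ᵖ_
  _+ᵖ_ : Pos → Pos → Pos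
  pos a p +ᵖ pos b q = pos (a + b) (+-pos p q)

  1ᵖ : Pos
  1ᵖ = pos 1ℝ 0<1

  inverseᵖ : ∀ r → ∃ λ s → s ·ᵖ r ≡ 1ᵖ
  inverseᵖ r with inverse (val r) (val-≢0 r)
  ... | y , ry≡1 = pos y (0≤y , 0≢y) , pos-≡ (trans (*-comm y (val r)) ry≡1)
    where
    0≢y : ¬ (0ℝ ≡ y)
    0≢y e = 0≢1 (trans (sym (zeroʳ (val r))) (trans (cong (val r *_) e) ry≡1))
    0≤y : 0ℝ ≤ y
    0≤y with total 0ℝ y
    ... | inj₁ p = p
    ... | inj₂ p = ⊥-elim (0≢1 (antisym (proj₁ 0<1) (0≤-a⇒a≤0
      (subst (0ℝ ≤_) (trans (sym (-‿distribʳ-* (val r) y)) (cong -_ ry≡1))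
        (*-nonneg (val-nonneg r) (a≤0⇒0≤-a p))))))

  ·ᵖ-comm : ∀ r s → r ·ᵖ s ≡ s ·ᵖ r
  ·ᵖ-comm r s = pos-≡ (*-comm (val r) (val s))

  ·ᵖ-assoc : ∀ r s t → (r ·ᵖ s) ·ᵖ t ≡ r ·ᵖ (s ·ᵖ t)
  ·ᵖ-assoc r s t = pos-≡ (*-assoc (val r) (val s) (val t))

  ·ᵖ-distribˡ : ∀ r s t → r ·ᵖ (s +ᵖ t) ≡ r ·ᵖ s +ᵖ r ·ᵖ t
  ·ᵖ-distribˡ r s t = pos-≡ (distribˡ (val r) (val s) (val t))

  ·ᵖ-distribʳ : ∀ r s t → (s +ᵖ t) ·ᵖ r ≡ s ·ᵖ r +ᵖ t ·ᵖ r
  ·ᵖ-distribʳ r s t = pos-≡ (distribʳ (val r) (val s) (val t))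

  ·ᵖ-identityˡ : ∀ r → 1ᵖ ·ᵖ r ≡ r
  ·ᵖ-identityˡ r = pos-≡ (*-identityˡ (val r))

  -- Nonnegative weights, 'nothing' being 0

  Wt : Set
  Wt = Maybe Pos

  valʷ : Wt → ℝ
  valʷ nothing  = 0ℝ
  valʷ (just r) = val r

  -- Zero is represented by `nothing` alone, so the laws of weights can be checked in ℝ.
  valʷ-injective : ∀ {m n} → valʷ m ≡ valʷ n → m ≡ n
  valʷ-injective {nothing} {nothing} e = refl
  valʷ-injective {nothing} {just s}  e = ⊥-elim (val-≢0 s (sym e))
  valʷ-injective {just r}  {nothing} e = ⊥-elim (val-≢0 r e)
  valʷ-injective {just r}  {just s}  e = cong just (pos-≡ e)

  infixl 6 _⊞_
  _⊞_ : Wt → Wt → Wt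
  nothing ⊞ n       = n
  just r  ⊞ nothing = just r
  just r  ⊞ just s  = just (r +ᵖ s)

  infixr 7 _·_
  _·_ : Pos → Wt → Wt
  r · nothing = nothing
  r · just s  = just (r ·ᵖ s)

  valʷ-⊞ : ∀ m n → valʷ (m ⊞ n) ≡ valʷ m + valʷ n
  valʷ-⊞ nothing  n        = sym (+-identityˡ _)
  valʷ-⊞ (just r) nothing  = sym (+-identityʳ _)
  valʷ-⊞ (just r) (just s) = refl

  ⊞-comm : ∀ m n → m ⊞ n ≡ n ⊞ m
  ⊞-comm m n = valʷ-injective (trans (valʷ-⊞ m n)
    (trans (+-comm _ _) (sym (valʷ-⊞ n m))))

  ⊞-assoc : ∀ l m n → (l ⊞ m) ⊞ n ≡ l ⊞ (m ⊞ n)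
  ⊞-assoc l m n = valʷ-injective (begin
    valʷ ((l ⊞ m) ⊞ n)         ≡⟨ valʷ-⊞ (l ⊞ m) n ⟩
    valʷ (l ⊞ m) + valʷ n      ≡⟨ cong (_+ valʷ n) (valʷ-⊞ l m) ⟩
    (valʷ l + valʷ m) + valʷ n ≡⟨ +-assoc _ _ _ ⟩
    valʷ l + (valʷ m + valʷ n) ≡⟨ cong (valʷ l +_) (valʷ-⊞ m n) ⟨
    valʷ l + valʷ (m ⊞ n)      ≡⟨ valʷ-⊞ l (m ⊞ n) ⟨
    valʷ (l ⊞ (m ⊞ n))         ∎)
    where open ≡-Reasoning

  ·-distribˡ-⊞ : ∀ r m n → r · (m ⊞ n) ≡ r · m ⊞ r · n
  ·-distribˡ-⊞ r nothing  n        = refl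
  ·-distribˡ-⊞ r (just s) nothing  = refl
  ·-distribˡ-⊞ r (just s) (just t) = cong just (·ᵖ-distribˡ r s t)

  ·-distribʳ-+ᵖ : ∀ r s m → (r +ᵖ s) · m ≡ r · m ⊞ s · m
  ·-distribʳ-+ᵖ r s nothing  = refl
  ·-distribʳ-+ᵖ r s (just t) = cong just (·ᵖ-distribʳ t r s)

  ·-assoc : ∀ r s m → (r ·ᵖ s) · m ≡ r · s · m
  ·-assoc r s nothing  = refl
  ·-assoc r s (just t) = cong just (·ᵖ-assoc r s t)

  ·-comm : ∀ r s m → r · s · m ≡ s · r · m
  ·-comm r s m = trans (sym (·-assoc r s m)) (trans (cong (_· m) (·ᵖ-comm r s)) (·-assoc s r m))

  ·-identity : ∀ m → 1ᵖ · m ≡ m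
  ·-identity nothing  = refl
  ·-identity (just r) = cong just (·ᵖ-identityˡ r)

  Wt-commutativeMonoid : CommutativeMonoid _ _
  Wt-commutativeMonoid = record
    { Carrier = Wt ; _≈_ = _≡_ ; _∙_ = _⊞_ ; ε = nothing
    ; isCommutativeMonoid = record
      { isMonoid = record
        { isSemigroup = record
          { isMagma = record { isEquivalence = isEquivalence ; ∙-cong = cong₂ _⊞_ }
          ; assoc = ⊞-assoc }
        ; identity = (λ _ → refl) , λ m → ⊞-comm m nothing }
      ; comm = ⊞-comm } }

  -- Sequents up to exchange and merging of weights

  infix 4 _≈_
  data _≈_ : Sequent → Sequent → Set where
    perm    : ∀ {Γ Δ} → Γ ↭ Δ → Γ ≈ Δ
    merge   : ∀ {Γ} r s A → (r +ᵖ s , A) ∷ Γ ≈ (r , A) ∷ (s , A) ∷ Γ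
    ≈-sym   : ∀ {Γ Δ} → Γ ≈ Δ → Δ ≈ Γ
    ≈-trans : ∀ {Γ Δ Θ} → Γ ≈ Δ → Δ ≈ Θ → Γ ≈ Θ

  ≈-refl : ∀ {Γ} → Γ ≈ Γ
  ≈-refl = perm ↭-refl

  ≈-reflexive : ∀ {Γ Δ} → Γ ≡ Δ → Γ ≈ Δ
  ≈-reflexive refl = ≈-refl

  ≈-++ʳ : ∀ {Γ Δ} Θ → Γ ≈ Δ → Γ ++ Θ ≈ Δ ++ Θ
  ≈-++ʳ Θ (perm p)      = perm (++⁺ʳ Θ p)
  ≈-++ʳ Θ (merge r s A) = merge r s A
  ≈-++ʳ Θ (≈-sym p)     = ≈-sym (≈-++ʳ Θ p)
  ≈-++ʳ Θ (≈-trans p q) = ≈-trans (≈-++ʳ Θ p) (≈-++ʳ Θ q)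

  ≈-comm : ∀ Γ Δ → Γ ++ Δ ≈ Δ ++ Γ
  ≈-comm Γ Δ = perm (++-comm Γ Δ)

  ≈-++ˡ : ∀ {Γ Δ} Θ → Γ ≈ Δ → Θ ++ Γ ≈ Θ ++ Δ
  ≈-++ˡ {Γ} {Δ} Θ p = ≈-trans (≈-comm Θ Γ) (≈-trans (≈-++ʳ Θ p) (≈-comm Δ Θ))

  ≈-++ : ∀ {Γ Γ' Δ Δ'} → Γ ≈ Γ' → Δ ≈ Δ' → Γ ++ Δ ≈ Γ' ++ Δ'
  ≈-++ {Γ' = Γ'} {Δ} p q = ≈-trans (≈-++ʳ Δ p) (≈-++ˡ Γ' q)

  Sequent-commutativeMonoid : CommutativeMonoid _ _
  Sequent-commutativeMonoid = record
    { Carrier = Sequent ; _≈_ = _≈_ ; _∙_ = _++_ ; ε = []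
    ; isCommutativeMonoid = record
      { isMonoid = record
        { isSemigroup = record
          { isMagma = record
            { isEquivalence = record { refl = ≈-refl ; sym = ≈-sym ; trans = ≈-trans }
            ; ∙-cong = ≈-++ }
          ; assoc = λ Γ Δ Θ → ≈-reflexive (++-assoc Γ Δ Θ) }
        ; identity = (λ _ → ≈-refl) , λ Γ → ≈-reflexive (++-identityʳ Γ) }
      ; comm = ≈-comm } }

  module SeqP = CSP (CommutativeMonoid.commutativeSemigroup Sequent-commutativeMonoid)
  module WtP = CSP (CommutativeMonoid.commutativeSemigroup Wt-commutativeMonoid)

  scaleS-≈ : ∀ c {Γ Δ} → Γ ≈ Δ → scaleS c Γ ≈ scaleS c Δ
  scaleS-≈ c (perm p)      = perm (map⁺ _ p)
  scaleS-≈ c {(.(r +ᵖ s) , A) ∷ Γ} (merge r s A) = ≈-trans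
    (≈-reflexive (cong (λ z → (z , A) ∷ scaleS c Γ) (·ᵖ-distribˡ c r s)))
    (merge (c ·ᵖ r) (c ·ᵖ s) A)
  scaleS-≈ c (≈-sym p)     = ≈-sym (scaleS-≈ c p)
  scaleS-≈ c (≈-trans p q) = ≈-trans (scaleS-≈ c p) (scaleS-≈ c q)

  scaleS-++ : ∀ c Γ Δ → scaleS c (Γ ++ Δ) ≡ scaleS c Γ ++ scaleS c Δ
  scaleS-++ c = map-++ _

  scaleS-+ᵖ : ∀ r s Γ → scaleS (r +ᵖ s) Γ ≈ scaleS r Γ ++ scaleS s Γ
  scaleS-+ᵖ r s []            = ≈-refl
  scaleS-+ᵖ r s ((t , A) ∷ Γ) = ≈-trans
    (≈-reflexive (cong (λ z → (z , A) ∷ scaleS (r +ᵖ s) Γ) (·ᵖ-distribʳ t r s)))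
    (≈-trans (merge (r ·ᵖ t) (s ·ᵖ t) A)
    (≈-trans (≈-++ˡ ((r ·ᵖ t , A) ∷ (s ·ᵖ t , A) ∷ []) (scaleS-+ᵖ r s Γ))
      (SeqP.interchange ((r ·ᵖ t , A) ∷ []) ((s ·ᵖ t , A) ∷ []) (scaleS r Γ) (scaleS s Γ))))

  scaleS-·ᵖ : ∀ r s Γ → scaleS (r ·ᵖ s) Γ ≡ scaleS r (scaleS s Γ)
  scaleS-·ᵖ r s []            = refl
  scaleS-·ᵖ r s ((t , A) ∷ Γ) = cong₂ (λ z → (z , A) ∷_) (·ᵖ-assoc r s t) (scaleS-·ᵖ r s Γ)

  scaleS-1 : ∀ Γ → scaleS 1ᵖ Γ ≡ Γ
  scaleS-1 []            = refl
  scaleS-1 ((t , A) ∷ Γ) = cong₂ (λ z → (z , A) ∷_) (·ᵖ-identityˡ t) (scaleS-1 Γ)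

  -- Cones of weighted sequents

  -- A set of pairs (m, Δ): Δ is a possible outcome of playing a term with weight m. The weight
  -- cannot be read off from Δ, and it is kept because summands must be played with equal weight.
  record Cone : Set₁ where
    field
      at    : Wt → Sequent → Set
      resp  : ∀ {m Δ Δ'} → Δ ≈ Δ' → at m Δ → at m Δ'
      apex  : at nothing []
      conv  : ∀ {m n Δ Δ'} → at m Δ → at n Δ' → at (m ⊞ n) (Δ ++ Δ')
      scale : ∀ {m Δ} c → at m Δ → at (c · m) (scaleS c Δ)
  open Cone

  infix 4 _⊆_
  _⊆_ : Cone → Cone → Set
  K ⊆ L = ∀ {m Δ} → at K m Δ → at L m Δ

  at-wt : ∀ K {m n Δ} → m ≡ n → at K m Δ → at K n Δ
  at-wt K {Δ = Δ} = subst (λ m → at K m Δ)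

  infixr 6 _⊗_
  infixr 5 _⊕ᶜ_
  infixr 7 _⊙ᶜ_

  -- Sum at a common weight, as r.(A + B) becomes r.A, r.B. By contrast `_⊕ᶜ_` shares the weight
  -- out: a maximum of two values is also the maximum of their convex combinations, which is what
  -- makes ⊔ a convex operation.
  _⊗_ : Cone → Cone → Cone
  at (K ⊗ L) m Δ = ∃ λ Δ₁ → ∃ λ Δ₂ → (Δ₁ ++ Δ₂ ≈ Δ) × at K m Δ₁ × at L m Δ₂
  resp (K ⊗ L) p (Δ₁ , Δ₂ , e , k , l) = Δ₁ , Δ₂ , ≈-trans e p , k , l
  apex (K ⊗ L) = [] , [] , ≈-refl , apex K , apex L
  conv (K ⊗ L) (Δ₁ , Δ₂ , e , k , l) (Δ₁' , Δ₂' , e' , k' , l') =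
    Δ₁ ++ Δ₁' , Δ₂ ++ Δ₂' , ≈-trans (SeqP.interchange Δ₁ Δ₁' Δ₂ Δ₂') (≈-++ e e') ,
    conv K k k' , conv L l l'
  scale (K ⊗ L) c (Δ₁ , Δ₂ , e , k , l) =
    scaleS c Δ₁ , scaleS c Δ₂ ,
    ≈-trans (≈-reflexive (sym (scaleS-++ c Δ₁ Δ₂))) (scaleS-≈ c e) , scale K c k , scale L c l

  _⊕ᶜ_ : Cone → Cone → Cone
  at (K ⊕ᶜ L) m Δ = ∃ λ m₁ → ∃ λ m₂ → ∃ λ Δ₁ → ∃ λ Δ₂ →
    (m₁ ⊞ m₂ ≡ m) × (Δ₁ ++ Δ₂ ≈ Δ) × at K m₁ Δ₁ × at L m₂ Δ₂
  resp (K ⊕ᶜ L) p (m₁ , m₂ , Δ₁ , Δ₂ , w , e , k , l) = m₁ , m₂ , Δ₁ , Δ₂ , w , ≈-trans e p , k , l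
  apex (K ⊕ᶜ L) = nothing , nothing , [] , [] , refl , ≈-refl , apex K , apex L
  conv (K ⊕ᶜ L) (m₁ , m₂ , Δ₁ , Δ₂ , refl , e , k , l) (n₁ , n₂ , Δ₁' , Δ₂' , refl , e' , k' , l') =
    m₁ ⊞ n₁ , m₂ ⊞ n₂ , Δ₁ ++ Δ₁' , Δ₂ ++ Δ₂' , WtP.interchange m₁ n₁ m₂ n₂ ,
    ≈-trans (SeqP.interchange Δ₁ Δ₁' Δ₂ Δ₂') (≈-++ e e') ,
    conv K k k' , conv L l l'
  scale (K ⊕ᶜ L) c (m₁ , m₂ , Δ₁ , Δ₂ , refl , e , k , l) =
    c · m₁ , c · m₂ , scaleS c Δ₁ , scaleS c Δ₂ , sym (·-distribˡ-⊞ c m₁ m₂) ,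
    ≈-trans (≈-reflexive (sym (scaleS-++ c Δ₁ Δ₂))) (scaleS-≈ c e) , scale K c k , scale L c l

  _⊙ᶜ_ : Pos → Cone → Cone
  at (r ⊙ᶜ K) m Δ = at K (r · m) Δ
  resp (r ⊙ᶜ K) = resp K
  apex (r ⊙ᶜ K) = apex K
  conv (r ⊙ᶜ K) {m} {n} k k' = at-wt K (sym (·-distribˡ-⊞ r m n)) (conv K k k')
  scale (r ⊙ᶜ K) {m} c k = at-wt K (·-comm c r m) (scale K c k)

  [_▹_] : Wt → Term → Sequent
  [ nothing ▹ A ] = []
  [ just r ▹ A ]  = (r , A) ∷ []

  ▹-⊞ : ∀ m n A → [ m ▹ A ] ++ [ n ▹ A ] ≈ [ m ⊞ n ▹ A ]
  ▹-⊞ nothing  n        A = ≈-refl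
  ▹-⊞ (just r) nothing  A = ≈-refl
  ▹-⊞ (just r) (just s) A = ≈-sym (merge r s A)

  scaleS-▹ : ∀ c m A → scaleS c [ m ▹ A ] ≡ [ c · m ▹ A ]
  scaleS-▹ c nothing  A = refl
  scaleS-▹ c (just r) A = refl

  rayᶜ : Term → Cone
  at (rayᶜ A) m Δ = [ m ▹ A ] ≈ Δ
  resp (rayᶜ A) p k = ≈-trans k p
  apex (rayᶜ A) = ≈-refl
  conv (rayᶜ A) {m} {n} k k' = ≈-trans (≈-sym (▹-⊞ m n A)) (≈-++ k k')
  scale (rayᶜ A) {m} c k = ≈-trans (≈-reflexive (sym (scaleS-▹ c m A))) (scaleS-≈ c k)

  -- The unit of `_⊗_`, with the empty sequent at every weight, whereas `⊥ᶜ`, the unit of `_⊕ᶜ_`,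
  -- has it at weight 0 only. The difference separates the derivable empty sequent from the
  -- hypersequent without components.
  0ᶜ : Cone
  at 0ᶜ m Δ = [] ≈ Δ
  resp 0ᶜ p k = ≈-trans k p
  apex 0ᶜ = ≈-refl
  conv 0ᶜ k k' = ≈-++ k k'
  scale 0ᶜ c k = scaleS-≈ c k

  ⊥ᶜ : Cone
  at ⊥ᶜ m Δ = (nothing ≡ m) × ([] ≈ Δ)
  resp ⊥ᶜ p (w , k) = w , ≈-trans k p
  apex ⊥ᶜ = refl , ≈-refl
  conv ⊥ᶜ (refl , k) (refl , k') = refl , ≈-++ k k'
  scale ⊥ᶜ c (refl , k) = refl , scaleS-≈ c k

  ⊗-mono : ∀ K K' L L' → K ⊆ K' → L ⊆ L' → K ⊗ L ⊆ K' ⊗ L'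
  ⊗-mono K K' L L' f g (Δ₁ , Δ₂ , e , k , l) = Δ₁ , Δ₂ , e , f k , g l

  ⊗-assocʳ : ∀ K L N → (K ⊗ L) ⊗ N ⊆ K ⊗ L ⊗ N
  ⊗-assocʳ K L N (Δ , Δ₃ , e , (Δ₁ , Δ₂ , e' , k , l) , m) =
    Δ₁ , Δ₂ ++ Δ₃ , ≈-trans (≈-reflexive (sym (++-assoc Δ₁ Δ₂ Δ₃))) (≈-trans (≈-++ʳ Δ₃ e') e) ,
    k , Δ₂ , Δ₃ , ≈-refl , l , m

  ⊗-assocˡ : ∀ K L N → K ⊗ L ⊗ N ⊆ (K ⊗ L) ⊗ N
  ⊗-assocˡ K L N (Δ₁ , Δ , e , k , Δ₂ , Δ₃ , e' , l , m) =
    Δ₁ ++ Δ₂ , Δ₃ , ≈-trans (≈-reflexive (++-assoc Δ₁ Δ₂ Δ₃)) (≈-trans (≈-++ˡ Δ₁ e') e) ,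
    (Δ₁ , Δ₂ , ≈-refl , k , l) , m

  ⊗-swap : ∀ K L N → K ⊗ L ⊗ N ⊆ L ⊗ K ⊗ N
  ⊗-swap K L N (Δ₁ , Δ , e , k , Δ₂ , Δ₃ , e' , l , m) =
    Δ₂ , Δ₁ ++ Δ₃ , ≈-trans (SeqP.x∙yz≈y∙xz Δ₂ Δ₁ Δ₃) (≈-trans (≈-++ˡ Δ₁ e') e) ,
    l , Δ₁ , Δ₃ , ≈-refl , k , m

  ⊕ᶜ-mono : ∀ K K' L L' → K ⊆ K' → L ⊆ L' → K ⊕ᶜ L ⊆ K' ⊕ᶜ L'
  ⊕ᶜ-mono K K' L L' f g (m₁ , m₂ , Δ₁ , Δ₂ , w , e , k , l) = m₁ , m₂ , Δ₁ , Δ₂ , w , e , f k , g l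

  ⊕ᶜ-assocˡ : ∀ K L N → K ⊕ᶜ L ⊕ᶜ N ⊆ (K ⊕ᶜ L) ⊕ᶜ N
  ⊕ᶜ-assocˡ K L N (m₁ , _ , Δ₁ , Δ , refl , e , k , m₂ , m₃ , Δ₂ , Δ₃ , refl , e' , l , m) =
    m₁ ⊞ m₂ , m₃ , Δ₁ ++ Δ₂ , Δ₃ , ⊞-assoc m₁ m₂ m₃ ,
    ≈-trans (≈-reflexive (++-assoc Δ₁ Δ₂ Δ₃)) (≈-trans (≈-++ˡ Δ₁ e') e) ,
    (m₁ , m₂ , Δ₁ , Δ₂ , refl , ≈-refl , k , l) , m

  ⊕ᶜ-swap : ∀ K L N → K ⊕ᶜ L ⊕ᶜ N ⊆ L ⊕ᶜ K ⊕ᶜ N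
  ⊕ᶜ-swap K L N (m₁ , _ , Δ₁ , Δ , refl , e , k , m₂ , m₃ , Δ₂ , Δ₃ , refl , e' , l , m) =
    m₂ , m₁ ⊞ m₃ , Δ₂ , Δ₁ ++ Δ₃ , WtP.x∙yz≈y∙xz m₂ m₁ m₃ ,
    ≈-trans (SeqP.x∙yz≈y∙xz Δ₂ Δ₁ Δ₃) (≈-trans (≈-++ˡ Δ₁ e') e) ,
    l , m₁ , m₃ , Δ₁ , Δ₃ , refl , ≈-refl , k , m

  ⊕ᶜ-idem : ∀ K → K ⊕ᶜ K ⊆ K
  ⊕ᶜ-idem K (m₁ , m₂ , Δ₁ , Δ₂ , refl , e , k , k') = resp K e (conv K k k')

  ⊙ᶜ-⊕ᶜ : ∀ r K L → r ⊙ᶜ (K ⊕ᶜ L) ⊆ r ⊙ᶜ K ⊕ᶜ r ⊙ᶜ L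
  ⊙ᶜ-⊕ᶜ r K L {m} (m₁ , m₂ , Δ₁ , Δ₂ , w , e , k , l) with inverseᵖ r
  -- The given weights split r · m; dividing them by r splits m.
  ... | s , sr≡1 = s · m₁ , s · m₂ , Δ₁ , Δ₂ ,
    trans (sym (·-distribˡ-⊞ s m₁ m₂)) (trans (cong (s ·_) w) (cancel' m)) , e ,
    at-wt K (sym (cancel m₁)) k , at-wt L (sym (cancel m₂)) l
    where
    cancel' : ∀ n → s · r · n ≡ n
    cancel' n = trans (sym (·-assoc s r n)) (trans (cong (_· n) sr≡1) (·-identity n))
    cancel : ∀ n → r · s · n ≡ n
    cancel n = trans (·-comm r s n) (cancel' n)

  ⊗-distribʳ-⊕ᶜ : ∀ K L N → (L ⊗ K) ⊕ᶜ (N ⊗ K) ⊆ (L ⊕ᶜ N) ⊗ K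
  ⊗-distribʳ-⊕ᶜ K L N (m₁ , m₂ , Δ₁ , Δ₂ , refl , e , (Δₗ , Δₖ , e₁ , l , k) , (Δₘ , Δₖ' , e₂ , m , k')) =
    Δₗ ++ Δₘ , Δₖ ++ Δₖ' ,
    ≈-trans (SeqP.interchange Δₗ Δₘ Δₖ Δₖ') (≈-trans (≈-++ e₁ e₂) e) ,
    (m₁ , m₂ , Δₗ , Δₘ , refl , ≈-refl , l , m) , conv K k k'

  ⊙ᶜ-⊕ᶜ⁻¹ : ∀ r K L → r ⊙ᶜ K ⊕ᶜ r ⊙ᶜ L ⊆ r ⊙ᶜ (K ⊕ᶜ L)
  ⊙ᶜ-⊕ᶜ⁻¹ r K L (m₁ , m₂ , Δ₁ , Δ₂ , refl , e , k , l) =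
    r · m₁ , r · m₂ , Δ₁ , Δ₂ , sym (·-distribˡ-⊞ r m₁ m₂) , e , k , l

  -- Interpretation of terms, sequents and hypersequents

  -- A strategy resolves every ⊓ outside the scope of a modality.
  Strat : Term → Set
  Strat (A ⊕ B) = Strat A × Strat B
  Strat (r ⊙ A) = Strat A
  Strat (A ⊔ B) = Strat A × Strat B
  Strat (A ⊓ B) = Strat A ⊎ Strat B
  Strat _       = ⊤

  ⟦_⟧ : ∀ A → Strat A → Cone
  ⟦ var x ⟧   _       = rayᶜ (var x)
  ⟦ covar x ⟧ _       = rayᶜ (covar x)
  ⟦ 𝟘 ⟧       _       = 0ᶜ
  ⟦ 𝟙 ⟧       _       = rayᶜ 𝟙
  ⟦ 𝟙̄ ⟧       _       = rayᶜ 𝟙̄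
  ⟦ A ⊕ B ⟧   (σ , τ) = ⟦ A ⟧ σ ⊗ ⟦ B ⟧ τ
  ⟦ r ⊙ A ⟧   σ       = r ⊙ᶜ ⟦ A ⟧ σ
  ⟦ A ⊔ B ⟧   (σ , τ) = ⟦ A ⟧ σ ⊕ᶜ ⟦ B ⟧ τ
  ⟦ A ⊓ B ⟧   (inj₁ σ) = ⟦ A ⟧ σ
  ⟦ A ⊓ B ⟧   (inj₂ τ) = ⟦ B ⟧ τ
  ⟦ ◇ A ⟧     _       = rayᶜ (◇ A)

  -- Used twice: a sequent is the `_⊗_` of its weighted terms, a hypersequent the `_⊕ᶜ_` of its
  -- sequents.
  module Fold {I : Set} (St : I → Set) (⟦_⟧ᵢ : ∀ i → St i → Cone)
              (_∙ᶜ_ : Cone → Cone → Cone) (εᶜ : Cone)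
              (∙-mono : ∀ K K' L L' → K ⊆ K' → L ⊆ L' → (K ∙ᶜ L) ⊆ (K' ∙ᶜ L'))
              (∙-swap : ∀ K L N → (K ∙ᶜ (L ∙ᶜ N)) ⊆ (L ∙ᶜ (K ∙ᶜ N))) where

    ⟪_⟫ : ∀ is → All St is → Cone
    ⟪ [] ⟫     []       = εᶜ
    ⟪ i ∷ is ⟫ (σ ∷ σs) = ⟦ i ⟧ᵢ σ ∙ᶜ ⟪ is ⟫ σs

    infix 4 _⊑_
    -- A simulation: strategies are translated backwards and witnesses forwards, so validity passes
    -- from left to right.
    _⊑_ : List I → List I → Set
    is ⊑ js = ∀ τ → ∃ λ σ → ⟪ is ⟫ σ ⊆ ⟪ js ⟫ τ

    ⊑-refl : ∀ {is} → is ⊑ is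
    ⊑-refl τ = τ , λ k → k

    ⊑-trans : ∀ {is js ks} → is ⊑ js → js ⊑ ks → is ⊑ ks
    ⊑-trans f g τ with g τ
    ... | σ , q with f σ
    ...   | ρ , p = ρ , λ k → q (p k)

    ⊑-cons : ∀ {i j is js} → (∀ τ → ∃ λ σ → ⟦ i ⟧ᵢ σ ⊆ ⟦ j ⟧ᵢ τ) → is ⊑ js → i ∷ is ⊑ j ∷ js
    ⊑-cons {i} {j} {is} {js} f g (τ ∷ τs) with f τ | g τs
    ... | σ , p | σs , q = σ ∷ σs , ∙-mono (⟦ i ⟧ᵢ σ) (⟦ j ⟧ᵢ τ) (⟪ is ⟫ σs) (⟪ js ⟫ τs) p q

    ↭⇒⊑ : ∀ {is js} → is ↭ js → is ⊑ js
    ↭⇒⊑ _↭_.refl = ⊑-refl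
    ↭⇒⊑ (prep i p) = ⊑-cons (λ τ → τ , λ k → k) (↭⇒⊑ p)
    ↭⇒⊑ (swap {xs = is} {ys = js} i j p) (τ ∷ σ ∷ τs) with ↭⇒⊑ p τs
    ... | ρ , q = σ ∷ τ ∷ ρ , λ k →
      ∙-mono _ _ (⟦ i ⟧ᵢ σ ∙ᶜ ⟪ is ⟫ ρ) (⟦ i ⟧ᵢ σ ∙ᶜ ⟪ js ⟫ τs) (λ l → l)
        (∙-mono _ _ (⟪ is ⟫ ρ) (⟪ js ⟫ τs) (λ l → l) q)
        (∙-swap (⟦ i ⟧ᵢ σ) (⟦ j ⟧ᵢ τ) (⟪ is ⟫ ρ) k)
    ↭⇒⊑ (_↭_.trans p q) = ⊑-trans (↭⇒⊑ p) (↭⇒⊑ q)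

  StratW : WTerm → Set
  StratW (r , A) = Strat A

  ⟦_⟧ʷ : ∀ p → StratW p → Cone
  ⟦ r , A ⟧ʷ σ = r ⊙ᶜ ⟦ A ⟧ σ

  open Fold StratW ⟦_⟧ʷ _⊗_ 0ᶜ ⊗-mono ⊗-swap public

  StratS : Sequent → Set
  StratS = All StratW

  module H = Fold StratS ⟪_⟫ _⊕ᶜ_ ⊥ᶜ ⊕ᶜ-mono ⊕ᶜ-swap

  Positive : Wt → Set
  Positive m = ∃ λ r → m ≡ just r

  positive-⊞ˡ : ∀ {m} n → Positive m → Positive (m ⊞ n)
  positive-⊞ˡ nothing  (r , refl) = r , refl
  positive-⊞ˡ (just s) (r , refl) = r +ᵖ s , refl

  positive-⊞ʳ : ∀ m {n} → Positive n → Positive (m ⊞ n)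
  positive-⊞ʳ m {n} p = subst Positive (⊞-comm n m) (positive-⊞ˡ m p)

  positive-· : ∀ c {m} → Positive m → Positive (c · m)
  positive-· c (r , refl) = c ·ᵖ r , refl

  positive-split : ∀ m n {r} → m ⊞ n ≡ just r → Positive m ⊎ Positive n
  positive-split nothing  (just s) _ = inj₂ (s , refl)
  positive-split (just r) n        _ = inj₁ (r , refl)

  Pos-commutativeSemigroup : CommutativeSemigroup _ _
  Pos-commutativeSemigroup = record
    { Carrier = Pos ; _≈_ = _≡_ ; _∙_ = _·ᵖ_
    ; isCommutativeSemigroup = record
      { isSemigroup = record
        { isMagma = record { isEquivalence = isEquivalence ; ∙-cong = cong₂ _·ᵖ_ }
        ; assoc = ·ᵖ-assoc }
      ; comm = ·ᵖ-comm } }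

  module PosP = CSP Pos-commutativeSemigroup

  scaleS-++-≈ : ∀ c Γ Δ {Θ} → Γ ++ Δ ≈ Θ → scaleS c Γ ++ scaleS c Δ ≈ scaleS c Θ
  scaleS-++-≈ c Γ Δ p = ≈-trans (≈-reflexive (sym (scaleS-++ c Γ Δ))) (scaleS-≈ c p)

  StratS-++ : ∀ Γ Δ (σ : StratS Γ) (τ : StratS Δ) →
    ∃ λ (ρ : StratS (Γ ++ Δ)) → ⟪ Γ ++ Δ ⟫ ρ ⊆ ⟪ Γ ⟫ σ ⊗ ⟪ Δ ⟫ τ
  StratS-++ []      Δ []      τ = τ , λ {_} {Θ} k → [] , Θ , ≈-refl , ≈-refl , k
  StratS-++ (p ∷ Γ) Δ (σ ∷ σs) τ with StratS-++ Γ Δ σs τ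
  ... | ρ , f = σ ∷ ρ , λ k → ⊗-assocˡ (⟦ p ⟧ʷ σ) (⟪ Γ ⟫ σs) (⟪ Δ ⟫ τ)
    (⊗-mono (⟦ p ⟧ʷ σ) (⟦ p ⟧ʷ σ) (⟪ Γ ++ Δ ⟫ ρ) (⟪ Γ ⟫ σs ⊗ ⟪ Δ ⟫ τ) (λ l → l) f k)

  StratS-++⁻ : ∀ Γ Δ (ρ : StratS (Γ ++ Δ)) →
    ∃ λ (σ : StratS Γ) → ∃ λ (τ : StratS Δ) → ⟪ Γ ⟫ σ ⊗ ⟪ Δ ⟫ τ ⊆ ⟪ Γ ++ Δ ⟫ ρ
  StratS-++⁻ [] Δ ρ = [] , ρ ,
    λ (Δ₁ , Δ₂ , e , k , l) → resp (⟪ Δ ⟫ ρ) (≈-trans (≈-++ʳ Δ₂ k) e) l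
  StratS-++⁻ (p ∷ Γ) Δ (ρ ∷ ρs) with StratS-++⁻ Γ Δ ρs
  ... | σ , τ , f = ρ ∷ σ , τ , λ k →
    ⊗-mono (⟦ p ⟧ʷ ρ) (⟦ p ⟧ʷ ρ) (⟪ Γ ⟫ σ ⊗ ⟪ Δ ⟫ τ) (⟪ Γ ++ Δ ⟫ ρs) (λ l → l) f
      (⊗-assocʳ (⟦ p ⟧ʷ ρ) (⟪ Γ ⟫ σ) (⟪ Δ ⟫ τ) k)

  StratS-scale : ∀ c Γ (σ : StratS Γ) →
    ∃ λ (τ : StratS (scaleS c Γ)) → ⟪ scaleS c Γ ⟫ τ ⊆ c ⊙ᶜ ⟪ Γ ⟫ σ
  StratS-scale c [] [] = [] , λ k → k
  StratS-scale c ((r , A) ∷ Γ) (σ ∷ σs) with StratS-scale c Γ σs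
  ... | τ , f = σ ∷ τ , λ {m} →
    ⊗-mono ((c ·ᵖ r) ⊙ᶜ ⟦ A ⟧ σ) (c ⊙ᶜ (r ⊙ᶜ ⟦ A ⟧ σ)) (⟪ scaleS c Γ ⟫ τ) (c ⊙ᶜ ⟪ Γ ⟫ σs)
      (λ {n} → at-wt (⟦ A ⟧ σ) (trans (·-assoc c r n) (·-comm c r n))) f {m}

  Σᵖ : Pos → List Pos → Pos
  Σᵖ r []       = r
  Σᵖ r (s ∷ rs) = r +ᵖ Σᵖ s rs

  val-Σᵖ : ∀ r rs → val (Σᵖ r rs) ≡ Σ⃗ (r ∷ rs)
  val-Σᵖ r []       = sym (+-identityʳ (val r))
  val-Σᵖ r (s ∷ rs) = cong (val r +_) (val-Σᵖ s rs)

  Σᵖ-scale : ∀ c r rs → Σᵖ (c ·ᵖ r) (scaleV c rs) ≡ c ·ᵖ Σᵖ r rs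
  Σᵖ-scale c r []       = refl
  Σᵖ-scale c r (s ∷ rs) = trans (cong (c ·ᵖ r +ᵖ_) (Σᵖ-scale c s rs)) (sym (·ᵖ-distribˡ c r (Σᵖ s rs)))

  Σ⃗-scale : ∀ c rs → Σ⃗ (scaleV c rs) ≡ val c * Σ⃗ rs
  Σ⃗-scale c []       = sym (zeroʳ (val c))
  Σ⃗-scale c (r ∷ rs) = trans (cong (_ +_) (Σ⃗-scale c rs)) (sym (distribˡ _ _ _))

  scaleS-∙ : ∀ c rs A → scaleS c (rs ∙ A) ≡ scaleV c rs ∙ A
  scaleS-∙ c []       A = refl
  scaleS-∙ c (r ∷ rs) A = cong (_ ∷_) (scaleS-∙ c rs A)

  -- Reduces the rules for vectors of weights to rules for one weighted term. The empty vector has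
  -- no positive total and is always treated apart.
  ∙-≈ : ∀ r rs A Γ → ((r ∷ rs) ∙ A) ++ Γ ≈ (Σᵖ r rs , A) ∷ Γ
  ∙-≈ r []       A Γ = ≈-refl
  ∙-≈ r (s ∷ rs) A Γ = ≈-trans (≈-++ˡ ((r , A) ∷ []) (∙-≈ s rs A Γ)) (≈-sym (merge r (Σᵖ s rs) A))

  total-≈ : ∀ Γ r rs A → Γ ++ ((r ∷ rs) ∙ A) ≈ (Σᵖ r rs , A) ∷ Γ
  total-≈ Γ r rs A = ≈-trans (≈-comm Γ ((r ∷ rs) ∙ A)) (∙-≈ r rs A Γ)

  total₂-≈ : ∀ Γ r rs s ss A B →
    Γ ++ ((r ∷ rs) ∙ A) ++ ((s ∷ ss) ∙ B) ≈ (Σᵖ r rs , A) ∷ (Σᵖ s ss , B) ∷ Γ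
  total₂-≈ Γ r rs s ss A B = ≈-trans (SeqP.x∙yz≈y∙xz Γ ((r ∷ rs) ∙ A) ((s ∷ ss) ∙ B))
    (≈-trans (∙-≈ r rs A (Γ ++ ((s ∷ ss) ∙ B))) (≈-++ˡ ((Σᵖ r rs , A) ∷ []) (total-≈ Γ s ss B)))

  -- Atoms are the terms denoting rays; 𝟘 is not one of them.
  data Atom : Term → Set where
    var   : ∀ x → Atom (var x)
    covar : ∀ x → Atom (covar x)
    one   : Atom 𝟙
    one̅   : Atom 𝟙̄
    dia   : ∀ A → Atom (◇ A)

  AtomW : WTerm → Set
  AtomW (r , A) = Atom A

  atom-strat : ∀ {A} → Atom A → Strat A
  atom-strat (var x)   = tt
  atom-strat (covar x) = tt
  atom-strat one       = tt
  atom-strat one̅       = tt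
  atom-strat (dia A)   = tt

  atom-ray : ∀ {A} → Atom A → ∀ σ → ⟦ A ⟧ σ ≡ rayᶜ A
  atom-ray (var x)   σ = refl
  atom-ray (covar x) σ = refl
  atom-ray one       σ = refl
  atom-ray one̅       σ = refl
  atom-ray (dia A)   σ = refl

  atom-cone : ∀ {A} → Atom A → ∀ σ {m Δ} → [ m ▹ A ] ≈ Δ → at (⟦ A ⟧ σ) m Δ
  atom-cone a σ {m} {Δ} = subst (λ K → at K m Δ) (sym (atom-ray a σ))

  atom-cone⁻¹ : ∀ {A} → Atom A → ∀ σ {m Δ} → at (⟦ A ⟧ σ) m Δ → [ m ▹ A ] ≈ Δ
  atom-cone⁻¹ a σ {m} {Δ} = subst (λ K → at K m Δ) (atom-ray a σ)

  scaleʷ : Wt → Sequent → Sequent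
  scaleʷ nothing  Γ = []
  scaleʷ (just c) Γ = scaleS c Γ

  scaleʷ-∷ : ∀ m r A Γ → [ r · m ▹ A ] ++ scaleʷ m Γ ≡ scaleʷ m ((r , A) ∷ Γ)
  scaleʷ-∷ nothing  r A Γ = refl
  scaleʷ-∷ (just c) r A Γ = cong (λ z → (z , A) ∷ scaleS c Γ) (·ᵖ-comm r c)

  atoms-cone : ∀ {Γ} → All AtomW Γ → ∀ σ m → at (⟪ Γ ⟫ σ) m (scaleʷ m Γ)
  atoms-cone [] [] nothing  = ≈-refl
  atoms-cone [] [] (just c) = ≈-refl
  atoms-cone {(r , A) ∷ Γ} (a ∷ as) (σ ∷ σs) m =
    [ r · m ▹ A ] , scaleʷ m Γ , ≈-reflexive (scaleʷ-∷ m r A Γ) ,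
    atom-cone a σ ≈-refl , atoms-cone as σs m

  -- Without ⊔ and ⊓ nothing is left to choose: the cone is the ray of multiples of Γ, which is what
  -- rule T produces.
  atoms-cone⁻¹ : ∀ {Γ} → All AtomW Γ → ∀ σ m {Δ} → at (⟪ Γ ⟫ σ) m Δ → scaleʷ m Γ ≈ Δ
  atoms-cone⁻¹ [] [] nothing  k = k
  atoms-cone⁻¹ [] [] (just c) k = k
  atoms-cone⁻¹ {(r , A) ∷ Γ} (a ∷ as) (σ ∷ σs) m (Δ₁ , Δ₂ , e , k , l) =
    ≈-trans (≈-reflexive (sym (scaleʷ-∷ m r A Γ)))
      (≈-trans (≈-++ (atom-cone⁻¹ a σ k) (atoms-cone⁻¹ as σs m l)) e)

  *-monoˡ-≤ : ∀ c {a b} → a ≤ b → val c * a ≤ val c * b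
  *-monoˡ-≤ c {a} {b} p = subst₂ _≤_ (+-identityˡ _) eq
    (+-mono-≤ (val c * a) (*-nonneg (val-nonneg c) (subst (_≤ b + - a) (-‿inverseʳ a) (+-mono-≤ (- a) p))))
    where
    eq : val c * (b + - a) + val c * a ≡ val c * b
    eq = trans (sym (distribˡ _ _ _)) (cong (val c *_)
      (trans (+-assoc b (- a) a) (trans (cong (b +_) (-‿inverseˡ a)) (+-identityʳ b))))

  -- Validity relative to a class of good sequents, and its closure under rules

  module Validity (Good : Sequent → Set) where

    -- The weight has to be positive because the apex always offers the empty sequent at weight 0.
    Meets : Cone → Set
    Meets K = ∃ λ r → ∃ λ Δ → at K (just r) Δ × Good Δ

    Valid : Hypersequent → Set
    Valid G = ∀ σ → Meets (H.⟪ G ⟫ σ)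

  record Laws (X : Sequent → Set) : Set where
    field
      resp-≈     : ∀ {Γ Δ} → Γ ≈ Δ → X Γ → X Δ
      resp-++    : ∀ {Γ Δ} → X Γ → X Δ → X (Γ ++ Δ)
      resp-scale : ∀ {Γ} c → X Γ → X (scaleS c Γ)

  module Layer {Good : Sequent → Set} (laws : Laws Good) where
    open Laws laws renaming (resp-≈ to good-≈; resp-++ to good-++; resp-scale to good-scale)
    open Validity Good

    meets : ∀ K {m Δ} → Positive m → at K m Δ → Good Δ → Meets K
    meets K (r , refl) k g = r , _ , k , g

    meets-mono : ∀ K L → K ⊆ L → Meets K → Meets L
    meets-mono K L f (r , Δ , k , g) = r , Δ , f k , g

    -- Witnesses with weight a on K and b on L are scaled crosswise, by b and a, to the common
    -- weight that `_⊗_` demands. A witness of weight 0 there suffices alone, the other factor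
    -- contributing its apex.
    meets-⊗ : ∀ K L H → Meets (K ⊕ᶜ H) → Meets (L ⊕ᶜ H) → Meets ((K ⊗ L) ⊕ᶜ H)
    meets-⊗ K L H (r , Δ , (nothing , n , Δ₁ , Δ₂ , w , e , k , h) , g) _ =
      r , Δ , (nothing , n , Δ₁ , Δ₂ , w , e ,
        (Δ₁ , [] , ≈-reflexive (++-identityʳ Δ₁) , k , apex L) , h) , g
    meets-⊗ K L H (_ , _ , (just _ , _) , _) (r , Δ , (nothing , n , Δ₁ , Δ₂ , w , e , l , h) , g) =
      r , Δ , (nothing , n , Δ₁ , Δ₂ , w , e , ([] , Δ₁ , ≈-refl , apex K , l) , h) , g
    meets-⊗ K L H (_ , Δ , (just a , n , Δ₁ , Δ₂ , _ , e , k , h) , g)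
                  (_ , Δ' , (just b , n' , Δ₁' , Δ₂' , _ , e' , l , h') , g') =
      meets ((K ⊗ L) ⊕ᶜ H) (positive-⊞ˡ (b · n ⊞ a · n') (b ·ᵖ a , refl))
        ( just (b ·ᵖ a) , b · n ⊞ a · n'
        , scaleS b Δ₁ ++ scaleS a Δ₁' , scaleS b Δ₂ ++ scaleS a Δ₂' , refl
        , ≈-trans (SeqP.interchange (scaleS b Δ₁) (scaleS a Δ₁') (scaleS b Δ₂) (scaleS a Δ₂'))
            (≈-++ (scaleS-++-≈ b Δ₁ Δ₂ e) (scaleS-++-≈ a Δ₁' Δ₂' e'))
        , ( scaleS b Δ₁ , scaleS a Δ₁' , ≈-refl , scale K b k
          , at-wt L (cong just (·ᵖ-comm a b)) (scale L a l))
        , conv H (scale H b h) (scale H a h'))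
        (good-++ (good-scale b g) (good-scale a g'))

    -- The witness for K gives weight b to N, the one for K' weight a to L;
    -- scaling them by a and b makes these two contributions interchangeable.
    meets-distrib : ∀ K K' L N H →
      Meets (((L ⊕ᶜ N) ⊗ K) ⊕ᶜ H) → Meets (((L ⊕ᶜ N) ⊗ K') ⊕ᶜ H) →
      Meets ((L ⊗ K) ⊕ᶜ (N ⊗ K') ⊕ᶜ H)
    meets-distrib K K' L N H
      (r , Δ , (m , h , Δ₁ , Δ₂ , w , e ,
        (Δₗₙ , Δₖ , e₁ , (m₁ , nothing , Δₗ , Δₙ , w' , e₂ , l , n) , k) , η) , g) _ =
      r , Δ ,
      ( m , h , Δₗ ++ Δₖ , Δₙ ++ Δ₂ , w
      , ≈-trans (SeqP.interchange Δₗ Δₖ Δₙ Δ₂) (≈-trans (≈-reflexive (sym (++-assoc (Δₗ ++ Δₙ) Δₖ Δ₂)))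
          (≈-trans (≈-++ʳ Δ₂ (≈-trans (≈-++ʳ Δₖ e₂) e₁)) e))
      , (Δₗ , Δₖ , ≈-refl , at-wt L (trans (⊞-comm nothing m₁) w') l , k)
      , nothing , h , Δₙ , Δ₂ , refl , ≈-refl
      , (Δₙ , [] , ≈-reflexive (++-identityʳ Δₙ) , n , apex K') , η) , g
    meets-distrib K K' L N H
      (_ , _ , (_ , _ , _ , _ , _ , _ , (_ , _ , _ , (_ , just _ , _) , _) , _) , _)
      (r , Δ , (m , h , Δ₁ , Δ₂ , w , e ,
        (Δₗₙ , Δₖ , e₁ , (nothing , m₂ , Δₗ , Δₙ , w' , e₂ , l , n) , k) , η) , g) =
      r , Δ ,
      ( nothing , m ⊞ h , Δₗ , (Δₙ ++ Δₖ) ++ Δ₂ , w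
      , ≈-trans (≈-reflexive (sym (++-assoc Δₗ (Δₙ ++ Δₖ) Δ₂)))
          (≈-trans (≈-++ʳ Δ₂ (≈-trans (≈-reflexive (sym (++-assoc Δₗ Δₙ Δₖ)))
            (≈-trans (≈-++ʳ Δₖ e₂) e₁))) e)
      , (Δₗ , [] , ≈-reflexive (++-identityʳ Δₗ) , l , apex K)
      , m , h , Δₙ ++ Δₖ , Δ₂ , refl , ≈-refl
      , (Δₙ , Δₖ , ≈-refl , at-wt N w' n , k) , η) , g
    meets-distrib K K' L N H
      (_ , Δ , (m , h , Δ₁ , Δ₂ , w , e ,
        (Δₗₙ , Δₖ , e₁ , (m₁ , just b , Δₗ , Δₙ , refl , e₂ , l , n) , k) , η) , g)
      (_ , Δ' , (m' , h' , Δ₁' , Δ₂' , w' , e' ,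
        (Δₗₙ' , Δₖ' , e₁' , (just a , m₂ , Δₗ' , Δₙ' , refl , e₂' , l' , n') , k') , η') , g') =
      meets ((L ⊗ K) ⊕ᶜ (N ⊗ K') ⊕ᶜ H) (positive-⊞ˡ (b · (just a ⊞ m₂) ⊞ (a · h ⊞ b · h'))
          (positive-· a (positive-⊞ʳ m₁ (b , refl))))
        ( a · (m₁ ⊞ just b) , b · (just a ⊞ m₂) ⊞ (a · h ⊞ b · h')
        , (a* Δₗ ++ b* Δₗ') ++ a* Δₖ , ((a* Δₙ ++ b* Δₙ') ++ b* Δₖ') ++ (a* Δ₂ ++ b* Δ₂')
        , refl
        , ≈-trans rearrange (≈-++
            (scaleS-++-≈ a ((Δₗ ++ Δₙ) ++ Δₖ) Δ₂ (≈-trans (≈-++ʳ Δ₂ (≈-trans (≈-++ʳ Δₖ e₂) e₁)) e))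
            (scaleS-++-≈ b ((Δₗ' ++ Δₙ') ++ Δₖ') Δ₂' (≈-trans (≈-++ʳ Δ₂' (≈-trans (≈-++ʳ Δₖ' e₂') e₁')) e')))
        , ( a* Δₗ ++ b* Δₗ' , a* Δₖ , ≈-refl
          , at-wt L (trans (cong (λ z → a · m₁ ⊞ just z) (·ᵖ-comm b a))
              (sym (·-distribˡ-⊞ a m₁ (just b)))) (conv L (scale L a l) (scale L b l'))
          , scale K a k)
        , b · (just a ⊞ m₂) , a · h ⊞ b · h'
        , (a* Δₙ ++ b* Δₙ') ++ b* Δₖ' , a* Δ₂ ++ b* Δ₂' , refl , ≈-refl
        , ( a* Δₙ ++ b* Δₙ' , b* Δₖ' , ≈-refl
          , at-wt N (trans (cong (λ z → just z ⊞ b · m₂) (·ᵖ-comm a b))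
              (sym (·-distribˡ-⊞ b (just a) m₂))) (conv N (scale N a n) (scale N b n'))
          , scale K' b k')
        , conv H (scale H a η) (scale H b η'))
        (good-++ (good-scale a g) (good-scale b g'))
      where
      a* = scaleS a
      b* = scaleS b
      open import Algebra.Solver.CommutativeMonoid Sequent-commutativeMonoid
        using (solve; _⊜_) renaming (_⊕_ to _∔_)
      rearrange : ((a* Δₗ ++ b* Δₗ') ++ a* Δₖ) ++ ((a* Δₙ ++ b* Δₙ') ++ b* Δₖ') ++ (a* Δ₂ ++ b* Δ₂')
        ≈ (a* ((Δₗ ++ Δₙ) ++ Δₖ) ++ a* Δ₂) ++ (b* ((Δₗ' ++ Δₙ') ++ Δₖ') ++ b* Δ₂')
      rearrange = ≈-trans
        (solve 8 (λ l l' k n n' k' h h' →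
          (((l ∔ l') ∔ k) ∔ (((n ∔ n') ∔ k') ∔ (h ∔ h'))) ⊜
          ((((l ∔ n) ∔ k) ∔ h) ∔ (((l' ∔ n') ∔ k') ∔ h')))
          ≈-refl (a* Δₗ) (b* Δₗ') (a* Δₖ) (a* Δₙ) (b* Δₙ') (b* Δₖ') (a* Δ₂) (b* Δ₂'))
        (≈-++ (≈-++ʳ (a* Δ₂) (≈-trans (≈-++ʳ (a* Δₖ) (scaleS-++-≈ a Δₗ Δₙ ≈-refl))
                (scaleS-++-≈ a (Δₗ ++ Δₙ) Δₖ ≈-refl)))
              (≈-++ʳ (b* Δ₂') (≈-trans (≈-++ʳ (b* Δₖ') (scaleS-++-≈ b Δₗ' Δₙ' ≈-refl))
                (scaleS-++-≈ b (Δₗ' ++ Δₙ') Δₖ' ≈-refl))))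

    -- A and B stand for one term under two strategies. Each hypothesis plays one of them with the
    -- full factor r + s, and a mixture in the right proportion gives them the factors r and s.
    meets-unmerge : ∀ r s A B K H →
      Meets (((r +ᵖ s) ⊙ᶜ A ⊗ K) ⊕ᶜ H) → Meets (((r +ᵖ s) ⊙ᶜ B ⊗ K) ⊕ᶜ H) →
      Meets ((r ⊙ᶜ A ⊗ s ⊙ᶜ B ⊗ K) ⊕ᶜ H)
    meets-unmerge r s A B K H
      (t , Δ , (nothing , h , Δ₁ , Δ₂ , w , e , (Δₐ , Δₖ , e₁ , a , k) , η) , g) _ =
      t , Δ , (nothing , h , Δ₁ , Δ₂ , w , e ,
        (Δₐ , Δₖ , e₁ , a , [] , Δₖ , ≈-refl , apex B , k) , η) , g
    meets-unmerge r s A B K H (_ , _ , (just _ , _) , _)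
      (t , Δ , (nothing , h , Δ₁ , Δ₂ , w , e , (Δₐ , Δₖ , e₁ , b , k) , η) , g) =
      t , Δ , (nothing , h , Δ₁ , Δ₂ , w , e ,
        ([] , Δ₁ , ≈-refl , apex A , Δₐ , Δₖ , e₁ , b , k) , η) , g
    meets-unmerge r s A B K H
      (_ , Δ , (just x , h , Δ₁ , Δ₂ , w , e , (Δₐ , Δₖ , e₁ , a , k) , η) , g)
      (_ , Δ' , (just y , h' , Δ₁' , Δ₂' , w' , e' , (Δᵦ , Δₖ' , e₁' , b , k') , η') , g') =
      meets ((r ⊙ᶜ A ⊗ s ⊙ᶜ B ⊗ K) ⊕ᶜ H) (positive-⊞ˡ (p · h ⊞ q · h') (t ·ᵖ (x ·ᵖ y) , refl))
        ( just (t ·ᵖ (x ·ᵖ y)) , p · h ⊞ q · h'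
        , p* Δₐ ++ q* Δᵦ ++ p* Δₖ ++ q* Δₖ' , p* Δ₂ ++ q* Δ₂' , refl
        , ≈-trans (≈-++ʳ (p* Δ₂ ++ q* Δ₂') (≈-trans
              (≈-reflexive (sym (++-assoc (p* Δₐ) (q* Δᵦ) (p* Δₖ ++ q* Δₖ'))))
              (≈-trans (SeqP.interchange (p* Δₐ) (q* Δᵦ) (p* Δₖ) (q* Δₖ'))
                (≈-++ (scaleS-++-≈ p Δₐ Δₖ e₁) (scaleS-++-≈ q Δᵦ Δₖ' e₁')))))
            (≈-trans (SeqP.interchange (p* Δ₁) (q* Δ₁') (p* Δ₂) (q* Δ₂'))
              (≈-++ (scaleS-++-≈ p Δ₁ Δ₂ e) (scaleS-++-≈ q Δ₁' Δ₂' e')))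
        , ( p* Δₐ , q* Δᵦ ++ p* Δₖ ++ q* Δₖ' , ≈-refl
          , at-wt A (cong just (trans (PosP.interchange r y t x)
              (trans (·ᵖ-assoc r t (y ·ᵖ x)) (cong (λ z → r ·ᵖ (t ·ᵖ z)) (·ᵖ-comm y x))))) (scale A p a)
          , q* Δᵦ , p* Δₖ ++ q* Δₖ' , ≈-refl
          , at-wt B (cong just (trans (PosP.interchange s x t y) (·ᵖ-assoc s t (x ·ᵖ y)))) (scale B q b)
          , at-wt K (cong just (trans
              (cong₂ _+ᵖ_ (trans (·ᵖ-assoc r y x) (cong (r ·ᵖ_) (·ᵖ-comm y x))) (·ᵖ-assoc s x y))
              (sym (·ᵖ-distribʳ (x ·ᵖ y) r s)))) (conv K (scale K p k) (scale K q k')))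
        , conv H (scale H p η) (scale H q η'))
        (good-++ (good-scale p g) (good-scale q g'))
      where
      t = r +ᵖ s
      -- With weights x and y in the two witnesses, scaling by r y and s x gives A weight r t x y, B
      -- weight s t x y and K weight r x y + s x y = t x y, so all three are played at t x y.
      p = r ·ᵖ y
      q = s ·ᵖ x
      p* = scaleS p
      q* = scaleS q

    valid-⊑ : ∀ {Γ Δ G} → Γ ⊑ Δ → Valid (Γ ∷ G) → Valid (Δ ∷ G)
    valid-⊑ {Γ} {Δ} {G} f v (τ ∷ τs) with f τ
    ... | σ , p = meets-mono (⟪ Γ ⟫ σ ⊕ᶜ H.⟪ G ⟫ τs) (⟪ Δ ⟫ τ ⊕ᶜ H.⟪ G ⟫ τs)
      (⊕ᶜ-mono (⟪ Γ ⟫ σ) (⟪ Δ ⟫ τ) (H.⟪ G ⟫ τs) (H.⟪ G ⟫ τs) p (λ k → k)) (v (σ ∷ τs))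

    valid-⊑ᴴ : ∀ {G G'} → G H.⊑ G' → Valid G → Valid G'
    valid-⊑ᴴ {G} {G'} f v τ with f τ
    ... | σ , p = meets-mono (H.⟪ G ⟫ σ) (H.⟪ G' ⟫ τ) p (v σ)

    valid-↭ᴴ : ∀ {G G'} → G ↭ G' → Valid G → Valid G'
    valid-↭ᴴ p = valid-⊑ᴴ (H.↭⇒⊑ p)

    valid-↭ : ∀ {Γ Γ' G} → Γ ↭ Γ' → Valid (Γ ∷ G) → Valid (Γ' ∷ G)
    valid-↭ p = valid-⊑ (↭⇒⊑ p)

    valid-[] : Good [] → Valid ([] ∷ [])
    valid-[] g ([] ∷ []) = 1ᵖ , [] , (just 1ᵖ , nothing , [] , [] , refl , ≈-refl , ≈-refl , refl , ≈-refl) , g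

    valid-W : ∀ {Γ G} → Valid G → Valid (Γ ∷ G)
    valid-W {Γ} v (σ ∷ σs) with v σs
    ... | r , Δ , k , g = r , Δ , (nothing , just r , [] , Δ , refl , ≈-refl , apex (⟪ Γ ⟫ σ) , k) , g

    valid-C : ∀ {Γ G} → Valid (Γ ∷ Γ ∷ G) → Valid (Γ ∷ G)
    valid-C {Γ} {G} v (σ ∷ σs) = meets-mono (K ⊕ᶜ K ⊕ᶜ H.⟪ G ⟫ σs) (K ⊕ᶜ H.⟪ G ⟫ σs) (λ k →
      ⊕ᶜ-mono (K ⊕ᶜ K) K (H.⟪ G ⟫ σs) (H.⟪ G ⟫ σs) (⊕ᶜ-idem K) (λ h → h)
        (⊕ᶜ-assocˡ K K (H.⟪ G ⟫ σs) k)) (v (σ ∷ σ ∷ σs))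
      where K = ⟪ Γ ⟫ σ

    -- The same good sequent serves: the weight of the joined sequent is given to both parts, so the
    -- total weight only grows.
    valid-S : ∀ {Γ₁ Γ₂ G} → Valid ((Γ₁ ++ Γ₂) ∷ G) → Valid (Γ₁ ∷ Γ₂ ∷ G)
    valid-S {Γ₁} {Γ₂} {G} v (σ ∷ τ ∷ τs) with StratS-++ Γ₁ Γ₂ σ τ
    ... | ρ , f with v (ρ ∷ τs)
    ... | r , Δ , (m , n , Δ₀ , Δ₃ , w , e , k , h) , g with f k
    ... | Δ₁ , Δ₂ , e' , k₁ , k₂ = meets (⟪ Γ₁ ⟫ σ ⊕ᶜ ⟪ Γ₂ ⟫ τ ⊕ᶜ H.⟪ G ⟫ τs) (positive-⊞ʳ m (r , w))
      ( m , m ⊞ n , Δ₁ , Δ₂ ++ Δ₃ , refl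
      , ≈-trans (≈-reflexive (sym (++-assoc Δ₁ Δ₂ Δ₃))) (≈-trans (≈-++ʳ Δ₃ e') e)
      , k₁ , m , n , Δ₂ , Δ₃ , refl , ≈-refl , k₂ , h) g

    valid-M : ∀ {Γ₁ Γ₂ G} → Valid (Γ₁ ∷ G) → Valid (Γ₂ ∷ G) → Valid ((Γ₁ ++ Γ₂) ∷ G)
    valid-M {Γ₁} {Γ₂} {G} v w (σ ∷ σs) with StratS-++⁻ Γ₁ Γ₂ σ
    ... | τ , τ' , f = meets-mono ((⟪ Γ₁ ⟫ τ ⊗ ⟪ Γ₂ ⟫ τ') ⊕ᶜ H.⟪ G ⟫ σs) (⟪ Γ₁ ++ Γ₂ ⟫ σ ⊕ᶜ H.⟪ G ⟫ σs)
      (⊕ᶜ-mono (⟪ Γ₁ ⟫ τ ⊗ ⟪ Γ₂ ⟫ τ') (⟪ Γ₁ ++ Γ₂ ⟫ σ) (H.⟪ G ⟫ σs) (H.⟪ G ⟫ σs) f (λ h → h))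
      (meets-⊗ (⟪ Γ₁ ⟫ τ) (⟪ Γ₂ ⟫ τ') (H.⟪ G ⟫ σs) (v (τ ∷ σs)) (w (τ' ∷ σs)))

    valid-T : ∀ {Γ G} c → Valid (scaleS c Γ ∷ G) → Valid (Γ ∷ G)
    valid-T {Γ} {G} c v (σ ∷ σs) with StratS-scale c Γ σ
    ... | τ , f with v (τ ∷ σs)
    ... | r , Δ , (m , n , Δ₁ , Δ₂ , w , e , k , h) , g = meets (⟪ Γ ⟫ σ ⊕ᶜ H.⟪ G ⟫ σs) positive
      (c · m , n , Δ₁ , Δ₂ , refl , e , f k , h) g
      where
      positive : Positive (c · m ⊞ n)
      positive with positive-split m n w
      ... | inj₁ p = positive-⊞ˡ n (positive-· c p)
      ... | inj₂ p = positive-⊞ʳ (c · m) p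

    valid-T⁻¹ : ∀ {Γ G} c → Valid (Γ ∷ G) → Valid (scaleS c Γ ∷ G)
    valid-T⁻¹ {Γ} {G} c v with inverseᵖ c
    ... | d , dc≡1 = valid-T d (subst (λ Γ → Valid (Γ ∷ G))
      (trans (sym (scaleS-1 Γ)) (trans (cong (λ z → scaleS z Γ) (sym dc≡1)) (scaleS-·ᵖ d c Γ))) v)

    valid-𝟘 : ∀ {r Γ G} → Valid (Γ ∷ G) → Valid (((r , 𝟘) ∷ Γ) ∷ G)
    valid-𝟘 = valid-⊑ λ { (tt ∷ τ) → τ , λ {_} {Δ} k → [] , Δ , ≈-refl , ≈-refl , k }

    valid-𝟘⁻¹ : ∀ {r Γ G} → Valid (((r , 𝟘) ∷ Γ) ∷ G) → Valid (Γ ∷ G)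
    valid-𝟘⁻¹ {Γ = Γ} = valid-⊑ λ τ → tt ∷ τ ,
      λ (Δ₁ , Δ₂ , e , k , l) → resp (⟪ Γ ⟫ τ) (≈-trans (≈-++ʳ Δ₂ k) e) l

    valid-⊕ : ∀ {r A B Γ G} → Valid (((r , A) ∷ (r , B) ∷ Γ) ∷ G) → Valid (((r , A ⊕ B) ∷ Γ) ∷ G)
    valid-⊕ {r} {A} {B} {Γ} = valid-⊑ λ { ((σ , σ') ∷ τ) → σ ∷ σ' ∷ τ ,
      ⊗-assocˡ (r ⊙ᶜ ⟦ A ⟧ σ) (r ⊙ᶜ ⟦ B ⟧ σ') (⟪ Γ ⟫ τ) }

    valid-⊕⁻¹ : ∀ {r A B Γ G} → Valid (((r , A ⊕ B) ∷ Γ) ∷ G) → Valid (((r , A) ∷ (r , B) ∷ Γ) ∷ G)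
    valid-⊕⁻¹ {r} {A} {B} {Γ} = valid-⊑ λ { (σ ∷ σ' ∷ τ) → (σ , σ') ∷ τ ,
      ⊗-assocʳ (r ⊙ᶜ ⟦ A ⟧ σ) (r ⊙ᶜ ⟦ B ⟧ σ') (⟪ Γ ⟫ τ) }

    valid-⊙ : ∀ {r s A Γ G} → Valid (((s ·ᵖ r , A) ∷ Γ) ∷ G) → Valid (((r , s ⊙ A) ∷ Γ) ∷ G)
    valid-⊙ {r} {s} {A} {Γ} = valid-⊑ (⊑-cons
      (λ τ → τ , λ {m} → at-wt (⟦ A ⟧ τ) (·-assoc s r m)) ⊑-refl)

    valid-⊙⁻¹ : ∀ {r s A Γ G} → Valid (((r , s ⊙ A) ∷ Γ) ∷ G) → Valid (((s ·ᵖ r , A) ∷ Γ) ∷ G)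
    valid-⊙⁻¹ {r} {s} {A} {Γ} = valid-⊑ (⊑-cons
      (λ τ → τ , λ {m} → at-wt (⟦ A ⟧ τ) (sym (·-assoc s r m))) ⊑-refl)

    valid-⊓ : ∀ {r A B Γ G} → Valid (((r , A) ∷ Γ) ∷ G) → Valid (((r , B) ∷ Γ) ∷ G) →
      Valid (((r , A ⊓ B) ∷ Γ) ∷ G)
    valid-⊓ v w ((inj₁ σ ∷ τ) ∷ τs) = v ((σ ∷ τ) ∷ τs)
    valid-⊓ v w ((inj₂ σ ∷ τ) ∷ τs) = w ((σ ∷ τ) ∷ τs)

    valid-⊓⁻¹₁ : ∀ {r A B Γ G} → Valid (((r , A ⊓ B) ∷ Γ) ∷ G) → Valid (((r , A) ∷ Γ) ∷ G)
    valid-⊓⁻¹₁ v ((σ ∷ τ) ∷ τs) = v ((inj₁ σ ∷ τ) ∷ τs)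

    valid-⊓⁻¹₂ : ∀ {r A B Γ G} → Valid (((r , A ⊓ B) ∷ Γ) ∷ G) → Valid (((r , B) ∷ Γ) ∷ G)
    valid-⊓⁻¹₂ v ((σ ∷ τ) ∷ τs) = v ((inj₂ σ ∷ τ) ∷ τs)

    valid-⊔ : ∀ {r A B Γ G} → Valid (((r , A) ∷ Γ) ∷ ((r , B) ∷ Γ) ∷ G) →
      Valid (((r , A ⊔ B) ∷ Γ) ∷ G)
    valid-⊔ {r} {A} {B} {Γ} {G} v (((σ , σ') ∷ τ) ∷ τs) = meets-mono
      ((K ⊗ N) ⊕ᶜ (L ⊗ N) ⊕ᶜ H) ((r ⊙ᶜ (⟦ A ⟧ σ ⊕ᶜ ⟦ B ⟧ σ') ⊗ N) ⊕ᶜ H)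
      (λ k → ⊕ᶜ-mono ((K ⊗ N) ⊕ᶜ (L ⊗ N)) (r ⊙ᶜ (⟦ A ⟧ σ ⊕ᶜ ⟦ B ⟧ σ') ⊗ N) H H
          (λ l → ⊗-mono (K ⊕ᶜ L) (r ⊙ᶜ (⟦ A ⟧ σ ⊕ᶜ ⟦ B ⟧ σ')) N N
            (⊙ᶜ-⊕ᶜ⁻¹ r (⟦ A ⟧ σ) (⟦ B ⟧ σ')) (λ n → n) (⊗-distribʳ-⊕ᶜ N K L l))
          (λ h → h)
        (⊕ᶜ-assocˡ (K ⊗ N) (L ⊗ N) H k))
      (v ((σ ∷ τ) ∷ (σ' ∷ τ) ∷ τs))
      where
      K = r ⊙ᶜ ⟦ A ⟧ σ
      L = r ⊙ᶜ ⟦ B ⟧ σ'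
      N = ⟪ Γ ⟫ τ
      H = H.⟪ G ⟫ τs

    -- The two copies of Γ may follow different strategies τ and τ', so the hypothesis is used
    -- against both, with the same answers inside A and B.
    valid-⊔⁻¹ : ∀ {r A B Γ G} → Valid (((r , A ⊔ B) ∷ Γ) ∷ G) →
      Valid (((r , A) ∷ Γ) ∷ ((r , B) ∷ Γ) ∷ G)
    valid-⊔⁻¹ {r} {A} {B} {Γ} {G} v ((σ ∷ τ) ∷ (σ' ∷ τ') ∷ τs) =
      meets-distrib (⟪ Γ ⟫ τ) (⟪ Γ ⟫ τ') (r ⊙ᶜ ⟦ A ⟧ σ) (r ⊙ᶜ ⟦ B ⟧ σ') (H.⟪ G ⟫ τs)
        (split τ) (split τ')
      where
      split : ∀ τ → Meets (((r ⊙ᶜ ⟦ A ⟧ σ ⊕ᶜ r ⊙ᶜ ⟦ B ⟧ σ') ⊗ ⟪ Γ ⟫ τ) ⊕ᶜ H.⟪ G ⟫ τs)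
      split τ = meets-mono
        ((r ⊙ᶜ (⟦ A ⟧ σ ⊕ᶜ ⟦ B ⟧ σ') ⊗ ⟪ Γ ⟫ τ) ⊕ᶜ H.⟪ G ⟫ τs)
        (((r ⊙ᶜ ⟦ A ⟧ σ ⊕ᶜ r ⊙ᶜ ⟦ B ⟧ σ') ⊗ ⟪ Γ ⟫ τ) ⊕ᶜ H.⟪ G ⟫ τs)
        (⊕ᶜ-mono (r ⊙ᶜ (⟦ A ⟧ σ ⊕ᶜ ⟦ B ⟧ σ') ⊗ ⟪ Γ ⟫ τ)
          ((r ⊙ᶜ ⟦ A ⟧ σ ⊕ᶜ r ⊙ᶜ ⟦ B ⟧ σ') ⊗ ⟪ Γ ⟫ τ) (H.⟪ G ⟫ τs) (H.⟪ G ⟫ τs)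
          (⊗-mono (r ⊙ᶜ (⟦ A ⟧ σ ⊕ᶜ ⟦ B ⟧ σ')) (r ⊙ᶜ ⟦ A ⟧ σ ⊕ᶜ r ⊙ᶜ ⟦ B ⟧ σ') (⟪ Γ ⟫ τ) (⟪ Γ ⟫ τ)
            (⊙ᶜ-⊕ᶜ r (⟦ A ⟧ σ) (⟦ B ⟧ σ')) (λ k → k)) (λ k → k))
        (v (((σ , σ') ∷ τ) ∷ τs))

    valid-unmerge : ∀ {r s A Γ G} → Valid (((r +ᵖ s , A) ∷ Γ) ∷ G) →
      Valid (((r , A) ∷ (s , A) ∷ Γ) ∷ G)
    valid-unmerge {r} {s} {A} {Γ} {G} v ((σ ∷ σ' ∷ τ) ∷ τs) =
      meets-unmerge r s (⟦ A ⟧ σ) (⟦ A ⟧ σ') (⟪ Γ ⟫ τ) (H.⟪ G ⟫ τs)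
        (v ((σ ∷ τ) ∷ τs)) (v ((σ' ∷ τ) ∷ τs))

    valid-merge : ∀ {r s A Γ G} → Valid (((r , A) ∷ (s , A) ∷ Γ) ∷ G) →
      Valid (((r +ᵖ s , A) ∷ Γ) ∷ G)
    valid-merge {r} {s} {A} {Γ} = valid-⊑ λ { (σ ∷ τ) → σ ∷ σ ∷ τ ,
      λ k → ⊗-mono (r ⊙ᶜ ⟦ A ⟧ σ ⊗ s ⊙ᶜ ⟦ A ⟧ σ) ((r +ᵖ s) ⊙ᶜ ⟦ A ⟧ σ) (⟪ Γ ⟫ τ) (⟪ Γ ⟫ τ)
        (λ {m} (Δ₁ , Δ₂ , e , l , l') → resp (⟦ A ⟧ σ) e
          (at-wt (⟦ A ⟧ σ) (sym (·-distribʳ-+ᵖ r s m)) (conv (⟦ A ⟧ σ) l l')))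
        (λ l → l)
        (⊗-assocˡ (r ⊙ᶜ ⟦ A ⟧ σ) (s ⊙ᶜ ⟦ A ⟧ σ) (⟪ Γ ⟫ τ) k) }

    valid-≈ : ∀ {Γ Γ' G} → Γ ≈ Γ' → Valid (Γ ∷ G) → Valid (Γ' ∷ G)
    valid-≈⁻¹ : ∀ {Γ Γ' G} → Γ ≈ Γ' → Valid (Γ' ∷ G) → Valid (Γ ∷ G)
    valid-≈ (perm p)      = valid-↭ p
    valid-≈ (merge r s A) = valid-unmerge
    valid-≈ (≈-sym p)     = valid-≈⁻¹ p
    valid-≈ (≈-trans p q) v = valid-≈ q (valid-≈ p v)
    valid-≈⁻¹ (perm p)      = valid-↭ (↭-sym p)
    valid-≈⁻¹ (merge r s A) = valid-merge
    valid-≈⁻¹ (≈-sym p)     = valid-≈ p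
    valid-≈⁻¹ (≈-trans p q) v = valid-≈⁻¹ p (valid-≈⁻¹ q v)

    -- Atoms denote rays, so any witness contains A and B with exactly the same weight, and removing
    -- the pair leaves a witness for the rest.
    valid-can-atom : ∀ {r A B Γ G} → Atom A → Atom B →
      (∀ c {Δ} → Good ((c , A) ∷ (c , B) ∷ Δ) → Good Δ) →
      Valid (((r , A) ∷ (r , B) ∷ Γ) ∷ G) → Valid (Γ ∷ G)
    valid-can-atom {r} {A} {B} {Γ} {G} a b can v (σ ∷ σs)
      with v ((atom-strat a ∷ atom-strat b ∷ σ) ∷ σs)
    ... | t , Δ , (m , n , Δ₁ , Δ₂ , w , e , (Δₐ , Δ' , e₁ , ka , (Δᵦ , Δₖ , e₂ , kb , k)) , h) , g =
      t , Δₖ ++ Δ₂ , (m , n , Δₖ , Δ₂ , w , ≈-refl , k , h) , cancel m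
        (good-≈ (≈-trans (≈-sym e) (≈-trans (≈-++ʳ Δ₂
            (≈-trans (≈-sym e₁) (≈-++ (≈-sym (atom-cone⁻¹ a _ ka))
              (≈-trans (≈-sym e₂) (≈-++ʳ Δₖ (≈-sym (atom-cone⁻¹ b _ kb)))))))
          (≈-reflexive (trans (++-assoc [ r · m ▹ A ] ([ r · m ▹ B ] ++ Δₖ) Δ₂)
            (cong ([ r · m ▹ A ] ++_) (++-assoc [ r · m ▹ B ] Δₖ Δ₂)))))) g)
      where
      cancel : ∀ m → Good ([ r · m ▹ A ] ++ [ r · m ▹ B ] ++ Δₖ ++ Δ₂) → Good (Δₖ ++ Δ₂)
      cancel nothing  g = g
      cancel (just c) g = can (r ·ᵖ c) g

    -- The common part of ID and 1: a witness playing Γ with weight m is extended by m times Θ,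
    -- hence by nothing if m is 0.
    valid-adjoin : ∀ {Γ G} Θ → All AtomW Θ → (∀ c {Δ} → Good Δ → Good (Δ ++ scaleS c Θ)) →
      Valid (Γ ∷ G) → Valid ((Γ ++ Θ) ∷ G)
    valid-adjoin {Γ} {G} Θ as adj v (ρ ∷ σs) with StratS-++⁻ Γ Θ ρ
    ... | σ , τ , f with v (σ ∷ σs)
    ... | r , Δ , (m , n , Δ₁ , Δ₂ , w , e , k , h) , g =
      r , Δ ++ scaleʷ m Θ
      , ( m , n , Δ₁ ++ scaleʷ m Θ , Δ₂ , w
        , ≈-trans (SeqP.xy∙z≈xz∙y Δ₁ (scaleʷ m Θ) Δ₂) (≈-++ʳ (scaleʷ m Θ) e)
        , f (Δ₁ , scaleʷ m Θ , ≈-refl , k , atoms-cone as τ m) , h)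
      , adjʷ m
      where
      adjʷ : ∀ m → Good (Δ ++ scaleʷ m Θ)
      adjʷ nothing  = good-≈ (≈-reflexive (sym (++-identityʳ Δ))) g
      adjʷ (just c) = adj c g

    valid-atoms : ∀ {Θ} → All AtomW Θ → Good Θ → Valid (Θ ∷ [])
    valid-atoms {Θ} as g (σ ∷ []) = 1ᵖ , Θ ,
      ( just 1ᵖ , nothing , scaleS 1ᵖ Θ , [] , refl
      , ≈-reflexive (trans (++-identityʳ _) (scaleS-1 Θ)) , atoms-cone as σ (just 1ᵖ) , refl , ≈-refl) , g

    valid-ZERO : ∀ {Γ G} rs → Valid (Γ ∷ G) → Valid ((Γ ++ (rs ∙ 𝟘)) ∷ G)
    valid-ZERO {Γ} {G} rs v = valid-↭ (++-comm (rs ∙ 𝟘) Γ) (go rs)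
      where
      go : ∀ rs → Valid (((rs ∙ 𝟘) ++ Γ) ∷ G)
      go []       = v
      go (r ∷ rs) = valid-𝟘 (go rs)

    valid-PLUS : ∀ {Γ G A B} rs → Valid ((Γ ++ (rs ∙ A) ++ (rs ∙ B)) ∷ G) →
      Valid ((Γ ++ (rs ∙ (A ⊕ B))) ∷ G)
    valid-PLUS []       v = v
    valid-PLUS {Γ} {A = A} {B} (r ∷ rs) v = valid-≈⁻¹ (total-≈ Γ r rs (A ⊕ B))
      (valid-⊕ (valid-≈ (total₂-≈ Γ r rs r rs A B) v))

    valid-TIMES : ∀ {Γ G A} s rs → Valid ((Γ ++ (scaleV s rs ∙ A)) ∷ G) →
      Valid ((Γ ++ (rs ∙ (s ⊙ A))) ∷ G)
    valid-TIMES s [] v = v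
    valid-TIMES {Γ} {G} {A} s (r ∷ rs) v = valid-≈⁻¹ (total-≈ Γ r rs (s ⊙ A))
      (valid-⊙ (subst (λ z → Valid (((z , A) ∷ Γ) ∷ G)) (Σᵖ-scale s r rs)
        (valid-≈ (total-≈ Γ (s ·ᵖ r) (scaleV s rs) A) v)))

    valid-JOIN : ∀ {Γ G A B} rs → Valid ((Γ ++ (rs ∙ A)) ∷ (Γ ++ (rs ∙ B)) ∷ G) →
      Valid ((Γ ++ (rs ∙ (A ⊔ B))) ∷ G)
    valid-JOIN [] v = valid-C v
    valid-JOIN {Γ} {G} {A} {B} (r ∷ rs) v = valid-≈⁻¹ (total-≈ Γ r rs (A ⊔ B))
      (valid-⊔ (valid-↭ᴴ (swap _ _ ↭-refl)
        (valid-≈ (total-≈ Γ r rs B) (valid-↭ᴴ (swap _ _ ↭-refl)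
          (valid-≈ (total-≈ Γ r rs A) v)))))

    valid-MEET : ∀ {Γ G A B} rs → Valid ((Γ ++ (rs ∙ A)) ∷ G) → Valid ((Γ ++ (rs ∙ B)) ∷ G) →
      Valid ((Γ ++ (rs ∙ (A ⊓ B))) ∷ G)
    valid-MEET [] v w = v
    valid-MEET {Γ} {G} {A} {B} (r ∷ rs) v w = valid-≈⁻¹ (total-≈ Γ r rs (A ⊓ B))
      (valid-⊓ (valid-≈ (total-≈ Γ r rs A) v) (valid-≈ (total-≈ Γ r rs B) w))

  -- Linear functionals on sequents

  lin : (Term → ℝ) → Sequent → ℝ
  lin f []            = 0ℝ
  lin f ((r , A) ∷ Γ) = val r * f A + lin f Γ

  lin-++ : ∀ f Γ Δ → lin f (Γ ++ Δ) ≡ lin f Γ + lin f Δ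
  lin-++ f []            Δ = sym (+-identityˡ _)
  lin-++ f ((r , A) ∷ Γ) Δ = trans (cong (val r * f A +_) (lin-++ f Γ Δ)) (sym (+-assoc _ _ _))

  lin-scale : ∀ f c Γ → lin f (scaleS c Γ) ≡ val c * lin f Γ
  lin-scale f c []            = sym (zeroʳ _)
  lin-scale f c ((r , A) ∷ Γ) =
    trans (cong₂ _+_ (*-assoc (val c) (val r) (f A)) (lin-scale f c Γ)) (sym (distribˡ _ _ _))

  lin-↭ : ∀ f {Γ Δ} → Γ ↭ Δ → lin f Γ ≡ lin f Δ
  lin-↭ f _↭_.refl        = refl
  lin-↭ f (prep _ p)      = cong (_ +_) (lin-↭ f p)
  lin-↭ f (swap {ys = Δ} (r , A) (s , B) p) =
    trans (cong (λ z → val r * f A + (val s * f B + z)) (lin-↭ f p))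
      (trans (sym (+-assoc _ _ _)) (trans (cong (_+ lin f Δ) (+-comm _ _)) (+-assoc _ _ _)))
  lin-↭ f (_↭_.trans p q) = trans (lin-↭ f p) (lin-↭ f q)

  lin-≈ : ∀ f {Γ Δ} → Γ ≈ Δ → lin f Γ ≡ lin f Δ
  lin-≈ f (perm p)      = lin-↭ f p
  lin-≈ f (merge {Γ} r s A) = trans (cong (_+ lin f Γ) (distribʳ (f A) (val r) (val s))) (+-assoc _ _ _)
  lin-≈ f (≈-sym p)     = sym (lin-≈ f p)
  lin-≈ f (≈-trans p q) = trans (lin-≈ f p) (lin-≈ f q)

  lin-∙ : ∀ f rs A → lin f (rs ∙ A) ≡ Σ⃗ rs * f A
  lin-∙ f []       A = sym (zeroˡ (f A))
  lin-∙ f (r ∷ rs) A = trans (cong (_ +_) (lin-∙ f rs A)) (sym (distribʳ (f A) (val r) (Σ⃗ rs)))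

  Odd : (Term → ℝ) → Set
  Odd f = ∀ A → f (neg A) ≡ - f A

  lin-pair : ∀ f → Odd f → ∀ r A Γ → lin f ((r , A) ∷ (r , neg A) ∷ Γ) ≡ lin f Γ
  lin-pair f odd r A Γ = begin
    val r * f A + (val r * f (neg A) + lin f Γ) ≡⟨ +-assoc _ _ _ ⟨
    (val r * f A + val r * f (neg A)) + lin f Γ ≡⟨ cong (_+ lin f Γ) (distribˡ _ _ _) ⟨
    val r * (f A + f (neg A)) + lin f Γ         ≡⟨ cong (λ z → val r * (f A + z) + lin f Γ) (odd A) ⟩
    val r * (f A + - f A) + lin f Γ             ≡⟨ cong (λ z → val r * z + lin f Γ) (-‿inverseʳ (f A)) ⟩
    val r * 0ℝ + lin f Γ                        ≡⟨ cong (_+ lin f Γ) (zeroʳ (val r)) ⟩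
    0ℝ + lin f Γ                                ≡⟨ +-identityˡ _ ⟩
    lin f Γ                                     ∎
    where open ≡-Reasoning

  lin-balanced : ∀ f → Odd f → ∀ rs ss A → Σ⃗ rs ≡ Σ⃗ ss → lin f ((rs ∙ A) ++ (ss ∙ neg A)) ≡ 0ℝ
  lin-balanced f odd rs ss A e = begin
    lin f ((rs ∙ A) ++ (ss ∙ neg A))        ≡⟨ lin-++ f (rs ∙ A) (ss ∙ neg A) ⟩
    lin f (rs ∙ A) + lin f (ss ∙ neg A)     ≡⟨ cong₂ _+_ (lin-∙ f rs A) (lin-∙ f ss (neg A)) ⟩
    Σ⃗ rs * f A + Σ⃗ ss * f (neg A)           ≡⟨ cong₂ (λ x y → Σ⃗ rs * f A + x * y) (sym e) (odd A) ⟩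
    Σ⃗ rs * f A + Σ⃗ rs * - f A               ≡⟨ distribˡ _ _ _ ⟨
    Σ⃗ rs * (f A + - f A)                    ≡⟨ cong (Σ⃗ rs *_) (-‿inverseʳ (f A)) ⟩
    Σ⃗ rs * 0ℝ                               ≡⟨ zeroʳ _ ⟩
    0ℝ                                      ∎
    where open ≡-Reasoning

  -- Signed multiplicity of a variable, and of 1
  χ : ℕ → Term → ℝ
  χ x (var y) with x ≟ y
  ... | yes _ = 1ℝ
  ... | no  _ = 0ℝ
  χ x (covar y) with x ≟ y
  ... | yes _ = - 1ℝ
  ... | no  _ = 0ℝ
  χ x _ = 0ℝ

  ω : Term → ℝ
  ω 𝟙 = 1ℝ
  ω 𝟙̄ = - 1ℝ
  ω _ = 0ℝ

  0≡-0 : 0ℝ ≡ - 0ℝ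
  0≡-0 = sym -0#≈0#

  χ-odd : ∀ x → Odd (χ x)
  χ-odd x (var y) with x ≟ y
  ... | yes _ = refl
  ... | no  _ = 0≡-0
  χ-odd x (covar y) with x ≟ y
  ... | yes _ = sym (-‿involutive 1ℝ)
  ... | no  _ = 0≡-0
  χ-odd x 𝟘       = 0≡-0
  χ-odd x 𝟙       = 0≡-0
  χ-odd x 𝟙̄       = 0≡-0
  χ-odd x (A ⊕ B) = 0≡-0
  χ-odd x (r ⊙ A) = 0≡-0
  χ-odd x (A ⊔ B) = 0≡-0
  χ-odd x (A ⊓ B) = 0≡-0
  χ-odd x (◇ A)   = 0≡-0

  ω-odd : Odd ω
  ω-odd (var y)   = 0≡-0
  ω-odd (covar y) = 0≡-0
  ω-odd 𝟘       = 0≡-0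
  ω-odd 𝟙       = refl
  ω-odd 𝟙̄       = sym (-‿involutive 1ℝ)
  ω-odd (A ⊕ B) = 0≡-0
  ω-odd (r ⊙ A) = 0≡-0
  ω-odd (A ⊔ B) = 0≡-0
  ω-odd (A ⊓ B) = 0≡-0
  ω-odd (◇ A)   = 0≡-0

  -- The side conditions of ID, for each variable, and of 1 and ◇, written with linear functionals
  -- so that they are preserved by addition, scaling and merging.
  Balanced : Sequent → Set
  Balanced Γ = (∀ x → lin (χ x) Γ ≡ 0ℝ) × 0ℝ ≤ lin ω Γ

  balanced-laws : Laws Balanced
  balanced-laws = record
    { resp-≈     = λ p (v , o) → (λ x → trans (sym (lin-≈ (χ x) p)) (v x)) , subst (0ℝ ≤_) (lin-≈ ω p) o
    ; resp-++    = λ {Γ} {Δ} (v , o) (v' , o') →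
        (λ x → trans (lin-++ (χ x) Γ Δ) (trans (cong₂ _+_ (v x) (v' x)) (+-identityˡ 0ℝ)))
        , subst (0ℝ ≤_) (sym (lin-++ ω Γ Δ)) (+-nonneg o o')
    ; resp-scale = λ {Γ} c (v , o) →
        (λ x → trans (lin-scale (χ x) c Γ) (trans (cong (val c *_) (v x)) (zeroʳ (val c))))
        , subst (0ℝ ≤_) (sym (lin-scale ω c Γ)) (*-nonneg (val-nonneg c) o) }

  balanced-pair : ∀ r A Γ → Balanced ((r , A) ∷ (r , neg A) ∷ Γ) → Balanced Γ
  balanced-pair r A Γ (v , o) =
    (λ x → trans (sym (lin-pair (χ x) (χ-odd x) r A Γ)) (v x)) ,
    subst (0ℝ ≤_) (lin-pair ω ω-odd r A Γ) o

  balanced-[] : Balanced []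
  balanced-[] = (λ x → refl) , ≤-refl

  vars : ℕ → List Pos → List Pos → Sequent
  vars x rs ss = (rs ∙ var x) ++ (ss ∙ covar x)

  balanced-vars : ∀ x rs ss → Σ⃗ rs ≡ Σ⃗ ss → Balanced (vars x rs ss)
  balanced-vars x rs ss e = (λ y → lin-balanced (χ y) (χ-odd y) rs ss (var x) e) ,
    ≤-reflexive (sym (lin-balanced ω ω-odd rs ss (var x) e))

  ones : List Pos → List Pos → Sequent
  ones rs ss = (rs ∙ 𝟙) ++ (ss ∙ 𝟙̄)

  lin-ones : ∀ f rs ss → lin f (ones rs ss) ≡ Σ⃗ rs * f 𝟙 + Σ⃗ ss * f 𝟙̄
  lin-ones f rs ss = trans (lin-++ f (rs ∙ 𝟙) (ss ∙ 𝟙̄)) (cong₂ _+_ (lin-∙ f rs 𝟙) (lin-∙ f ss 𝟙̄))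

  ω-ones : ∀ rs ss → lin ω (ones rs ss) ≡ Σ⃗ rs + - Σ⃗ ss
  ω-ones rs ss = trans (lin-ones ω rs ss) (cong₂ _+_ (*-identityʳ _)
    (trans (sym (-‿distribʳ-* (Σ⃗ ss) 1ℝ)) (cong -_ (*-identityʳ _))))

  balanced-ones : ∀ rs ss → Σ⃗ ss ≤ Σ⃗ rs → Balanced (ones rs ss)
  balanced-ones rs ss p =
    (λ x → trans (lin-ones (χ x) rs ss) (trans (cong₂ _+_ (zeroʳ _) (zeroʳ _)) (+-identityˡ 0ℝ))) ,
    subst₂ _≤_ (-‿inverseʳ _) (sym (ω-ones rs ss)) (+-mono-≤ (- Σ⃗ ss) p)

  -- The premise of the ◇ rule with conclusion a given sequent of atoms
  undia₁ : WTerm → Sequent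
  undia₁ (r , ◇ A) = (r , A) ∷ []
  undia₁ (r , 𝟙)   = (r , 𝟙) ∷ []
  undia₁ (r , 𝟙̄)   = (r , 𝟙̄) ∷ []
  undia₁ _         = []

  undia : Sequent → Sequent
  undia []      = []
  undia (p ∷ Γ) = undia₁ p ++ undia Γ

  undia-++ : ∀ Γ Δ → undia (Γ ++ Δ) ≡ undia Γ ++ undia Δ
  undia-++ []      Δ = refl
  undia-++ (p ∷ Γ) Δ = trans (cong (undia₁ p ++_) (undia-++ Γ Δ)) (sym (++-assoc (undia₁ p) _ _))

  undia-scale : ∀ c Γ → undia (scaleS c Γ) ≡ scaleS c (undia Γ)
  undia-scale c []      = refl
  undia-scale c ((r , A) ∷ Γ) = trans (cong₂ _++_ (undia₁-scale A) (undia-scale c Γ))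
    (sym (scaleS-++ c (undia₁ (r , A)) (undia Γ)))
    where
    undia₁-scale : ∀ A → undia₁ (c ·ᵖ r , A) ≡ scaleS c (undia₁ (r , A))
    undia₁-scale (var x)   = refl
    undia₁-scale (covar x) = refl
    undia₁-scale 𝟘         = refl
    undia₁-scale 𝟙         = refl
    undia₁-scale 𝟙̄         = refl
    undia₁-scale (A ⊕ B)   = refl
    undia₁-scale (s ⊙ A)   = refl
    undia₁-scale (A ⊔ B)   = refl
    undia₁-scale (A ⊓ B)   = refl
    undia₁-scale (◇ A)     = refl

  undia-↭ : ∀ {Γ Δ} → Γ ↭ Δ → undia Γ ↭ undia Δ
  undia-↭ _↭_.refl        = ↭-refl
  undia-↭ (prep p q)      = ++⁺ˡ (undia₁ p) (undia-↭ q)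
  undia-↭ {Γ = _ ∷ _ ∷ Γ} {Δ = _ ∷ _ ∷ Δ} (swap p p' q) = ↭-trans (shifts (undia₁ p) (undia₁ p'))
    (++⁺ˡ (undia₁ p') (++⁺ˡ (undia₁ p) (undia-↭ q)))
  undia-↭ (_↭_.trans p q) = ↭-trans (undia-↭ p) (undia-↭ q)

  undia-≈ : ∀ {Γ Δ} → Γ ≈ Δ → undia Γ ≈ undia Δ
  undia-≈ (perm p)      = perm (undia-↭ p)
  undia-≈ {_ ∷ Γ} (merge r s A) = undia₁-merge A
    where
    undia₁-merge : ∀ A → undia ((r +ᵖ s , A) ∷ Γ) ≈ undia ((r , A) ∷ (s , A) ∷ Γ)
    undia₁-merge (var x)   = ≈-refl
    undia₁-merge (covar x) = ≈-refl
    undia₁-merge 𝟘         = ≈-refl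
    undia₁-merge 𝟙         = merge r s 𝟙
    undia₁-merge 𝟙̄         = merge r s 𝟙̄
    undia₁-merge (A ⊕ B)   = ≈-refl
    undia₁-merge (_ ⊙ A)   = ≈-refl
    undia₁-merge (A ⊔ B)   = ≈-refl
    undia₁-merge (A ⊓ B)   = ≈-refl
    undia₁-merge (◇ A)     = merge r s A
  undia-≈ (≈-sym p)     = ≈-sym (undia-≈ p)
  undia-≈ (≈-trans p q) = ≈-trans (undia-≈ p) (undia-≈ q)

  undia-∙𝟙 : ∀ rs → undia (rs ∙ 𝟙) ≡ rs ∙ 𝟙
  undia-∙𝟙 []       = refl
  undia-∙𝟙 (r ∷ rs) = cong (_ ∷_) (undia-∙𝟙 rs)

  undia-∙𝟙̄ : ∀ rs → undia (rs ∙ 𝟙̄) ≡ rs ∙ 𝟙̄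
  undia-∙𝟙̄ []       = refl
  undia-∙𝟙̄ (r ∷ rs) = cong (_ ∷_) (undia-∙𝟙̄ rs)

  undia-ones : ∀ rs ss → undia (ones rs ss) ≡ ones rs ss
  undia-ones rs ss = trans (undia-++ (rs ∙ 𝟙) (ss ∙ 𝟙̄)) (cong₂ _++_ (undia-∙𝟙 rs) (undia-∙𝟙̄ ss))

  undia-◇S : ∀ Γ → undia (◇S Γ) ≡ Γ
  undia-◇S []      = refl
  undia-◇S (_ ∷ Γ) = cong (_ ∷_) (undia-◇S Γ)

  undia-∙var : ∀ rs x → undia (rs ∙ var x) ≡ []
  undia-∙var []       x = refl
  undia-∙var (r ∷ rs) x = undia-∙var rs x

  undia-∙covar : ∀ rs x → undia (rs ∙ covar x) ≡ []
  undia-∙covar []       x = refl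
  undia-∙covar (r ∷ rs) x = undia-∙covar rs x

  undia-vars : ∀ x rs ss → undia (vars x rs ss) ≡ []
  undia-vars x rs ss = trans (undia-++ (rs ∙ var x) (ss ∙ covar x))
    (cong₂ _++_ (undia-∙var rs x) (undia-∙covar ss x))

  -- Levels of validity, and the rules for atoms and ◇

  Good : (Sequent → Set) → Sequent → Set
  Good X Δ = Balanced Δ × X (undia Δ)

  good-laws : ∀ {X} → Laws X → Laws (Good X)
  good-laws {X} laws = record
    { resp-≈     = λ p (b , x) → B.resp-≈ p b , L.resp-≈ (undia-≈ p) x
    ; resp-++    = λ {Γ} {Δ} (b , x) (b' , x') → B.resp-++ {Γ} {Δ} b b' ,
        subst X (sym (undia-++ Γ Δ)) (L.resp-++ x x')
    ; resp-scale = λ {Γ} c (b , x) → B.resp-scale {Γ} c b ,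
        subst X (sym (undia-scale c Γ)) (L.resp-scale c x) }
    where
    module L = Laws laws
    module B = Laws balanced-laws

  data One : Term → Set where
    𝟙 : One 𝟙
    𝟙̄ : One 𝟙̄

  OneW : WTerm → Set
  OneW (r , A) = One A

  -- 'Valid' calls 'Premise' on sequents of smaller modal depth; the level n
  -- unrolls this recursion. Level 0 allows no further atom than 1 and its negation.
  Premise : ℕ → Sequent → Set
  Premise zero    Γ = All OneW Γ × Balanced Γ
  Premise (suc n) Γ = Validity.Valid (Good (Premise n)) (Γ ∷ [])

  all-one-≈ : ∀ {Γ Δ} → Γ ≈ Δ → All OneW Γ → All OneW Δ
  all-one-≈⁻¹ : ∀ {Γ Δ} → Γ ≈ Δ → All OneW Δ → All OneW Γ
  all-one-≈ (perm p)      as       = All-resp-↭ p as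
  all-one-≈ (merge r s A) (a ∷ as) = a ∷ a ∷ as
  all-one-≈ (≈-sym p)     as       = all-one-≈⁻¹ p as
  all-one-≈ (≈-trans p q) as       = all-one-≈ q (all-one-≈ p as)
  all-one-≈⁻¹ (perm p)      as           = All-resp-↭ (↭-sym p) as
  all-one-≈⁻¹ (merge r s A) (a ∷ _ ∷ as) = a ∷ as
  all-one-≈⁻¹ (≈-sym p)     as           = all-one-≈ p as
  all-one-≈⁻¹ (≈-trans p q) as           = all-one-≈⁻¹ p (all-one-≈⁻¹ q as)

  -- This closes the recursion on levels: what mixing witnesses on one level requires of ◇ premises
  -- is M, inverse T and merging on the level below.
  premise-laws : ∀ n → Laws (Premise n)
  premise-laws zero = record
    { resp-≈     = λ p (a , b) → all-one-≈ p a , B.resp-≈ p b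
    ; resp-++    = λ {Γ} {Δ} (a , b) (a' , b') → All.++⁺ a a' , B.resp-++ {Γ} {Δ} b b'
    ; resp-scale = λ {Γ} c (a , b) → All.map⁺ a , B.resp-scale {Γ} c b }
    where module B = Laws balanced-laws
  premise-laws (suc n) = record
    { resp-≈ = valid-≈ ; resp-++ = valid-M ; resp-scale = valid-T⁻¹ }
    where open Layer (good-laws (premise-laws n))

  module Level (n : ℕ) = Layer (good-laws (premise-laws n))

  Valid : ℕ → Hypersequent → Set
  Valid n = Validity.Valid (Good (Premise n))

  premise-[] : ∀ n → Premise n []
  premise-[] zero    = [] , balanced-[]
  premise-[] (suc n) = Level.valid-[] n (balanced-[] , premise-[] n)

  ∙-atoms : ∀ rs {A} → Atom A → All AtomW (rs ∙ A)
  ∙-atoms []       a = []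
  ∙-atoms (r ∷ rs) a = a ∷ ∙-atoms rs a

  ∙-ones : ∀ rs {A} → One A → All OneW (rs ∙ A)
  ∙-ones []       a = []
  ∙-ones (r ∷ rs) a = a ∷ ∙-ones rs a

  ones-atoms : ∀ rs ss → All AtomW (ones rs ss)
  ones-atoms rs ss = All.++⁺ (∙-atoms rs one) (∙-atoms ss one̅)

  -- Since `undia` keeps the 1's, adjoining them to a witness also adjoins them to its ◇ premise one
  -- level down; hence the simultaneous induction with `valid-ONE`.
  premise-ones : ∀ n {Γ} rs ss → Σ⃗ ss ≤ Σ⃗ rs → Premise n Γ → Premise n (Γ ++ ones rs ss)
  valid-ONE : ∀ n {Γ G} rs ss → Σ⃗ ss ≤ Σ⃗ rs → Valid n (Γ ∷ G) → Valid n ((Γ ++ ones rs ss) ∷ G)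

  premise-ones zero {Γ} rs ss p (a , b) = All.++⁺ a (All.++⁺ (∙-ones rs 𝟙) (∙-ones ss 𝟙̄)) ,
    Laws.resp-++ balanced-laws {Γ} b (balanced-ones rs ss p)
  premise-ones (suc n) rs ss p v = valid-ONE n rs ss p v

  valid-ONE n rs ss p = Level.valid-adjoin n (ones rs ss) (ones-atoms rs ss) λ c {Δ} (b , x) →
    B.resp-++ {Δ} b (B.resp-scale {ones rs ss} c (balanced-ones rs ss p)) ,
    subst (Premise n) (trans (cong (undia Δ ++_) (trans (sym (scaleS-ones c))
        (sym (trans (undia-scale c (ones rs ss)) (cong (scaleS c) (undia-ones rs ss))))))
      (sym (undia-++ Δ (scaleS c (ones rs ss)))))
      (premise-ones n (scaleV c rs) (scaleV c ss) (Σ⃗-scale-mono c) x)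
    where
    module B = Laws balanced-laws
    scaleS-ones : ∀ c → scaleS c (ones rs ss) ≡ ones (scaleV c rs) (scaleV c ss)
    scaleS-ones c = trans (scaleS-++ c (rs ∙ 𝟙) (ss ∙ 𝟙̄)) (cong₂ _++_ (scaleS-∙ c rs 𝟙) (scaleS-∙ c ss 𝟙̄))
    Σ⃗-scale-mono : ∀ c → Σ⃗ (scaleV c ss) ≤ Σ⃗ (scaleV c rs)
    Σ⃗-scale-mono c = subst₂ _≤_ (sym (Σ⃗-scale c ss)) (sym (Σ⃗-scale c rs)) (*-monoˡ-≤ c p)

  valid-ID : ∀ n {Γ G} x rs ss → Σ⃗ rs ≡ Σ⃗ ss → Valid n (Γ ∷ G) →
    Valid n ((Γ ++ vars x rs ss) ∷ G)
  valid-ID n x rs ss e = Level.valid-adjoin n Θ (All.++⁺ (∙-atoms rs (var x)) (∙-atoms ss (covar x)))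
    λ c {Δ} (b , p) → B.resp-++ {Δ} b (B.resp-scale {Θ} c (balanced-vars x rs ss e)) ,
      subst (Premise n) (sym (trans (undia-++ Δ (scaleS c Θ)) (trans (cong (undia Δ ++_)
        (trans (undia-scale c Θ) (cong (scaleS c) (undia-vars x rs ss)))) (++-identityʳ (undia Δ))))) p
    where
    module B = Laws balanced-laws
    Θ = vars x rs ss

  lin-◇S : ∀ f → (∀ A → f (◇ A) ≡ 0ℝ) → ∀ Γ → lin f (◇S Γ) ≡ 0ℝ
  lin-◇S f z []            = refl
  lin-◇S f z ((r , A) ∷ Γ) = trans (cong₂ _+_ (trans (cong (val r *_) (z A)) (zeroʳ (val r)))
    (lin-◇S f z Γ)) (+-identityˡ 0ℝ)

  -- The conclusion consists of atoms and is its own witness with weight 1; `undia` recovers the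
  -- premise from it, at the cost of one level.
  valid-DIA : ∀ n {Γ} rs ss → Σ⃗ ss ≤ Σ⃗ rs → Valid n ((Γ ++ ones rs ss) ∷ []) →
    Valid (suc n) ((◇S Γ ++ ones rs ss) ∷ [])
  valid-DIA n {Γ} rs ss p v = Level.valid-atoms (suc n) (All.++⁺ (◇S-atoms Γ) (ones-atoms rs ss))
    ( Laws.resp-++ balanced-laws {◇S Γ} (◇S-balanced Γ) (balanced-ones rs ss p)
    , subst (Premise (suc n)) (sym (trans (undia-++ (◇S Γ) (ones rs ss))
        (cong₂ _++_ (undia-◇S Γ) (undia-ones rs ss)))) v)
    where
    ◇S-atoms : ∀ Γ → All AtomW (◇S Γ)
    ◇S-atoms []      = []
    ◇S-atoms (p ∷ Γ) = dia _ ∷ ◇S-atoms Γ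
    ◇S-balanced : ∀ Γ → Balanced (◇S Γ)
    ◇S-balanced Γ = (λ x → lin-◇S (χ x) (λ _ → refl) Γ) , ≤-reflexive (sym (lin-◇S ω (λ _ → refl) Γ))

  -- Cancellation

  Cancel : Term → Term → Set
  Cancel A B = ∀ n {r Γ G} → Valid n (((r , A) ∷ (r , B) ∷ Γ) ∷ G) → Valid n (Γ ∷ G)

  cancel-sym : ∀ {A B} → Cancel A B → Cancel B A
  cancel-sym c n v = c n (Level.valid-↭ n (swap _ _ ↭-refl) v)

  -- Taking A' for the meet and inverting ⊔ gives a component with the pair A, A', which cancels,
  -- and a mixed one with B, A'; taking B' leaves the mixed one with A, B'. Neither mixed component
  -- cancels alone, but M joins them into one containing both pairs. The resulting copies of Γ are
  -- fused by S and C.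
  cancel-⊔⊓ : ∀ {A B A' B'} → Cancel A A' → Cancel B B' → Cancel (A ⊔ B) (A' ⊓ B')
  cancel-⊔⊓ {A} {B} {A'} {B'} canA canB n {r} {Γ} {G} v =
    valid-C (valid-C (valid-S (canA n (canB n (valid-↭ reorder (valid-M left right))))))
    where
    open Level n
    branches : ∀ {C} → Valid n (((r , C) ∷ (r , A ⊔ B) ∷ Γ) ∷ G) →
      Valid n (((r , A) ∷ (r , C) ∷ Γ) ∷ ((r , B) ∷ (r , C) ∷ Γ) ∷ G)
    branches w = valid-⊔⁻¹ (valid-↭ (swap _ _ ↭-refl) w)
    v' : Valid n (((r , A' ⊓ B') ∷ (r , A ⊔ B) ∷ Γ) ∷ G)
    v' = valid-↭ (swap _ _ ↭-refl) v
    left : Valid n (((r , B) ∷ (r , A') ∷ Γ) ∷ Γ ∷ G)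
    left = valid-↭ᴴ (swap _ _ ↭-refl) (canA n (branches (valid-⊓⁻¹₁ v')))
    right : Valid n (((r , A) ∷ (r , B') ∷ Γ) ∷ Γ ∷ G)
    right = valid-↭ᴴ (swap _ _ ↭-refl) (canB n (valid-↭ᴴ (swap _ _ ↭-refl) (branches (valid-⊓⁻¹₂ v'))))
    reorder : ((r , B) ∷ (r , A') ∷ Γ) ++ ((r , A) ∷ (r , B') ∷ Γ) ↭
      (r , B) ∷ (r , B') ∷ (r , A) ∷ (r , A') ∷ Γ ++ Γ
    reorder = prep _ (↭-trans (prep _ (↭-trans (shift _ Γ _) (prep _ (shift _ Γ _))))
      (↭-trans (swap _ _ ↭-refl) (↭-trans (prep _ (swap _ _ ↭-refl)) (swap _ _ ↭-refl))))

  -- The pair reappears in the ◇ premise and has to be cancelled there as well, whence the induction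
  -- on the level.
  cancel-𝟙 : ∀ n {r Γ G} → Valid n (((r , 𝟙) ∷ (r , 𝟙̄) ∷ Γ) ∷ G) → Valid n (Γ ∷ G)
  cancel-𝟙 zero = Level.valid-can-atom zero one one̅ λ { c {Δ} (b , _ ∷ _ ∷ a , b') →
    balanced-pair c 𝟙 Δ b , a , balanced-pair c 𝟙 (undia Δ) b' }
  cancel-𝟙 (suc n) = Level.valid-can-atom (suc n) one one̅ λ c {Δ} (b , v) →
    balanced-pair c 𝟙 Δ b , cancel-𝟙 n v

  cancel : ∀ A → Cancel A (neg A)
  cancel (var x)   n = Level.valid-can-atom n (var x) (covar x) λ c {Δ} (b , v) → balanced-pair c (var x) Δ b , v
  cancel (covar x) n = Level.valid-can-atom n (covar x) (var x) λ c {Δ} (b , v) → balanced-pair c (covar x) Δ b , v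
  cancel 𝟘 n v = Level.valid-𝟘⁻¹ n (Level.valid-𝟘⁻¹ n v)
  cancel 𝟙 = cancel-𝟙
  cancel 𝟙̄ = cancel-sym cancel-𝟙
  cancel (A ⊕ B) n {r} {Γ} v = cancel A n (cancel B n (valid-↭ reorder
    (valid-⊕⁻¹ (valid-↭ (shift _ ((r , A) ∷ (r , B) ∷ []) Γ) (valid-⊕⁻¹ v)))))
    where
    open Level n
    reorder : (r , neg A) ∷ (r , neg B) ∷ (r , A) ∷ (r , B) ∷ Γ ↭
      (r , B) ∷ (r , neg B) ∷ (r , A) ∷ (r , neg A) ∷ Γ
    reorder = ↭-trans (shifts ((r , neg A) ∷ []) ((r , neg B) ∷ (r , A) ∷ (r , B) ∷ []))
      (↭-trans (shifts ((r , neg B) ∷ (r , A) ∷ []) ((r , B) ∷ [])) ↭-refl)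
  cancel (s ⊙ A) n v = cancel A n (Level.valid-↭ n (swap _ _ ↭-refl) (Level.valid-⊙⁻¹ n
    (Level.valid-↭ n (swap _ _ ↭-refl) (Level.valid-⊙⁻¹ n v))))
  cancel (A ⊔ B) = cancel-⊔⊓ (cancel A) (cancel B)
  cancel (A ⊓ B) = cancel-sym (cancel-⊔⊓ (cancel-sym (cancel A)) (cancel-sym (cancel B)))
  -- In the ◇ premise the pair becomes A and its negation. On level 0 balance alone lets it go;
  -- above that the induction hypothesis for A applies one level down.
  cancel (◇ A) zero = Level.valid-can-atom zero (dia A) (dia (neg A)) λ { c {Δ} (b , _ ∷ _ ∷ a , b') →
    balanced-pair c (◇ A) Δ b , a , balanced-pair c A (undia Δ) b' }
  cancel (◇ A) (suc n) = Level.valid-can-atom (suc n) (dia A) (dia (neg A)) λ c {Δ} (b , v) →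
    balanced-pair c (◇ A) Δ b , cancel A n v

  valid-CAN : ∀ n {Γ G} A rs ss → Σ⃗ rs ≡ Σ⃗ ss →
    Valid n ((Γ ++ (ss ∙ A) ++ (rs ∙ neg A)) ∷ G) → Valid n (Γ ∷ G)
  valid-CAN n {Γ} {G} A [] [] e v = subst (λ Γ → Valid n (Γ ∷ G)) (++-identityʳ Γ) v
  valid-CAN n A [] (s ∷ ss) e = ⊥-elim (val-≢0 (Σᵖ s ss) (trans (val-Σᵖ s ss) (sym e)))
  valid-CAN n A (r ∷ rs) [] e = ⊥-elim (val-≢0 (Σᵖ r rs) (trans (val-Σᵖ r rs) e))
  valid-CAN n {Γ} {G} A (r ∷ rs) (s ∷ ss) e v = cancel A n
    (subst (λ z → Valid n (((Σᵖ s ss , A) ∷ (z , neg A) ∷ Γ) ∷ G))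
      (pos-≡ (trans (val-Σᵖ r rs) (trans e (sym (val-Σᵖ s ss)))))
      (Level.valid-≈ n (total₂-≈ Γ s ss r rs A (neg A)) v))

  -- Soundness of all rules, CAN included

  EventuallyValid : Hypersequent → Set
  EventuallyValid G = ∃ λ N → ∀ n → N ℕ.≤ n → Valid n G

  -- Each ◇ costs one level, so the premises of M and ⊓ may be reached at different levels. Asking
  -- for validity on all levels from N on lets them meet at the larger bound without comparing
  -- levels.
  soundness : ∀ {b G} → Deriv b G → EventuallyValid G
  soundness (exH p d) with soundness d
  ... | N , v = N , λ n q → Level.valid-↭ᴴ n p (v n q)
  soundness (exS p d) with soundness d
  ... | N , v = N , λ n q → Level.valid-↭ n p (v n q)
  soundness INIT = 0 , λ n _ → premise-[] (suc n)
  soundness (W d) with soundness d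
  ... | N , v = N , λ n q → Level.valid-W n (v n q)
  soundness (C d) with soundness d
  ... | N , v = N , λ n q → Level.valid-C n (v n q)
  soundness (S d) with soundness d
  ... | N , v = N , λ n q → Level.valid-S n (v n q)
  soundness (M d d') with soundness d | soundness d'
  ... | N , v | N' , v' = N ℕ.⊔ N' , λ n q → Level.valid-M n
    (v n (ℕ.m⊔n≤o⇒m≤o N N' q)) (v' n (ℕ.m⊔n≤o⇒n≤o N N' q))
  soundness (T r d) with soundness d
  ... | N , v = N , λ n q → Level.valid-T n r (v n q)
  soundness (ID x rs ss e d) with soundness d
  ... | N , v = N , λ n q → valid-ID n x rs ss e (v n q)
  soundness (ZERO rs d) with soundness d
  ... | N , v = N , λ n q → Level.valid-ZERO n rs (v n q)
  soundness (PLUS rs d) with soundness d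
  ... | N , v = N , λ n q → Level.valid-PLUS n rs (v n q)
  soundness (TIMES s rs d) with soundness d
  ... | N , v = N , λ n q → Level.valid-TIMES n s rs (v n q)
  soundness (JOIN rs d) with soundness d
  ... | N , v = N , λ n q → Level.valid-JOIN n rs (v n q)
  soundness (MEET rs d d') with soundness d | soundness d'
  ... | N , v | N' , v' = N ℕ.⊔ N' , λ n q → Level.valid-MEET n rs
    (v n (ℕ.m⊔n≤o⇒m≤o N N' q)) (v' n (ℕ.m⊔n≤o⇒n≤o N N' q))
  soundness (CAN A rs ss e d) with soundness d
  ... | N , v = N , λ n q → valid-CAN n A rs ss e (v n q)
  soundness (ONE rs ss p d) with soundness d
  ... | N , v = N , λ n q → valid-ONE n rs ss p (v n q)
  soundness (DIA {Γ = Γ} rs ss p d) with soundness d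
  ... | N , v = suc N , λ { (suc n) (ℕ.s≤s q) → valid-DIA n {Γ} rs ss p (v n q) }

  -- Reading off CAN-free derivations

  CANFree : Hypersequent → Set
  CANFree = Deriv false

  a-b≡0⇒a≡b : ∀ {a b} → a + - b ≡ 0ℝ → a ≡ b
  a-b≡0⇒a≡b {a} {b} e = trans (sym (+-identityʳ a)) (trans (cong (a +_) (sym (-‿inverseˡ b)))
    (trans (sym (+-assoc a (- b) b)) (trans (cong (_+ b) e) (+-identityˡ b))))

  0≤a-b⇒b≤a : ∀ {a b} → 0ℝ ≤ a + - b → b ≤ a
  0≤a-b⇒b≤a {a} {b} p = subst₂ _≤_ (+-identityˡ b)
    (trans (+-assoc a (- b) b) (trans (cong (a +_) (-‿inverseˡ b)) (+-identityʳ a))) (+-mono-≤ b p)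

  -- The bound drives the removal of variables, largest first. At bound 0 only 1, its negation and ◇
  -- terms remain, the shape of a conclusion of ◇.
  data Below (N : ℕ) : Term → Set where
    var   : ∀ {x} → x ℕ.< N → Below N (var x)
    covar : ∀ {x} → x ℕ.< N → Below N (covar x)
    one   : Below N 𝟙
    one̅   : Below N 𝟙̄
    dia   : ∀ {A} → Below N (◇ A)

  BelowW : ℕ → WTerm → Set
  BelowW N (r , A) = Below N A

  below-mono : ∀ {K N A} → K ℕ.≤ N → Below K A → Below N A
  below-mono p (var q)   = var (ℕ.≤-trans q p)
  below-mono p (covar q) = covar (ℕ.≤-trans q p)
  below-mono p one       = one
  below-mono p one̅       = one̅
  below-mono p dia       = dia

  atom-below : ∀ {A} → Atom A → ∃ λ N → Below N A
  atom-below (var x)   = suc x , var ℕ.≤-refl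
  atom-below (covar x) = suc x , covar ℕ.≤-refl
  atom-below one       = 0 , one
  atom-below one̅       = 0 , one̅
  atom-below (dia A)   = 0 , dia

  atoms-below : ∀ {Γ} → All AtomW Γ → ∃ λ N → All (BelowW N) Γ
  atoms-below [] = 0 , []
  atoms-below (a ∷ as) with atom-below a | atoms-below as
  ... | K , p | N , ps = K ℕ.⊔ N ,
    below-mono (ℕ.m≤m⊔n K N) p ∷ All.map (below-mono (ℕ.m≤n⊔m K N)) ps

  extract-vars : ∀ N Δ → All (BelowW (suc N)) Δ → ∃ λ Θ → ∃ λ rs → ∃ λ ss →
    All (BelowW N) Θ × Δ ↭ Θ ++ vars N rs ss
  extract-vars N [] [] = [] , [] , [] , [] , ↭-refl
  extract-vars N (p ∷ Δ) (b ∷ bs) with extract-vars N Δ bs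
  extract-vars N ((r , var x) ∷ Δ) (var q ∷ bs) | Θ , rs , ss , cs , π with x ≟ N
  ... | yes refl = Θ , r ∷ rs , ss , cs , ↭-trans (prep _ π) (↭-sym (shift _ Θ (vars N rs ss)))
  ... | no x≢N   = (r , var x) ∷ Θ , rs , ss , var (ℕ.≤∧≢⇒< (ℕ.s≤s⁻¹ q) x≢N) ∷ cs , prep _ π
  extract-vars N ((r , covar x) ∷ Δ) (covar q ∷ bs) | Θ , rs , ss , cs , π with x ≟ N
  ... | yes refl = Θ , rs , r ∷ ss , cs , ↭-trans (prep _ π) (↭-sym (↭-trans
    (++⁺ˡ Θ (shift _ (rs ∙ var N) (ss ∙ covar N))) (shift _ Θ (vars N rs ss))))
  ... | no x≢N   = (r , covar x) ∷ Θ , rs , ss , covar (ℕ.≤∧≢⇒< (ℕ.s≤s⁻¹ q) x≢N) ∷ cs , prep _ π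
  extract-vars N (p ∷ Δ) (one ∷ bs) | Θ , rs , ss , cs , π = p ∷ Θ , rs , ss , one ∷ cs , prep p π
  extract-vars N (p ∷ Δ) (one̅ ∷ bs) | Θ , rs , ss , cs , π = p ∷ Θ , rs , ss , one̅ ∷ cs , prep p π
  extract-vars N (p ∷ Δ) (dia ∷ bs) | Θ , rs , ss , cs , π = p ∷ Θ , rs , ss , dia ∷ cs , prep p π

  χ-below : ∀ {N A} → Below N A → χ N A ≡ 0ℝ
  χ-below {N} (var {x} q) with N ≟ x
  ... | yes refl = ⊥-elim (ℕ.<-irrefl refl q)
  ... | no _     = refl
  χ-below {N} (covar {x} q) with N ≟ x
  ... | yes refl = ⊥-elim (ℕ.<-irrefl refl q)
  ... | no _     = refl
  χ-below one = refl
  χ-below one̅ = refl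
  χ-below dia = refl

  lin-below : ∀ {N Γ} → All (BelowW N) Γ → lin (χ N) Γ ≡ 0ℝ
  lin-below [] = refl
  lin-below {Γ = (r , A) ∷ Γ} (b ∷ bs) = trans
    (cong₂ _+_ (trans (cong (val r *_) (χ-below b)) (zeroʳ (val r))) (lin-below bs)) (+-identityˡ 0ℝ)

  χ-var : ∀ x → χ x (var x) ≡ 1ℝ
  χ-var x with x ≟ x
  ... | yes _  = refl
  ... | no x≢x = ⊥-elim (x≢x refl)

  lin-vars : ∀ x rs ss → lin (χ x) (vars x rs ss) ≡ Σ⃗ rs + - Σ⃗ ss
  lin-vars x rs ss = begin
    lin (χ x) (vars x rs ss)
      ≡⟨ lin-++ (χ x) (rs ∙ var x) (ss ∙ covar x) ⟩
    lin (χ x) (rs ∙ var x) + lin (χ x) (ss ∙ covar x)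
      ≡⟨ cong₂ _+_ (lin-∙ (χ x) rs (var x)) (lin-∙ (χ x) ss (covar x)) ⟩
    Σ⃗ rs * χ x (var x) + Σ⃗ ss * χ x (covar x)
      ≡⟨ cong₂ (λ a b → Σ⃗ rs * a + Σ⃗ ss * b) (χ-var x)
           (trans (χ-odd x (var x)) (cong -_ (χ-var x))) ⟩
    Σ⃗ rs * 1ℝ + Σ⃗ ss * - 1ℝ
      ≡⟨ cong₂ _+_ (*-identityʳ _)
           (trans (sym (-‿distribʳ-* (Σ⃗ ss) 1ℝ)) (cong -_ (*-identityʳ _))) ⟩
    Σ⃗ rs + - Σ⃗ ss ∎
    where open ≡-Reasoning

  extract-◇ : ∀ {Δ} → All (BelowW 0) Δ → ∃ λ Γ → ∃ λ rs → ∃ λ ss → Δ ↭ ◇S Γ ++ ones rs ss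
  extract-◇ [] = [] , [] , [] , ↭-refl
  extract-◇ {(r , _) ∷ Δ} (b ∷ bs) with extract-◇ bs
  extract-◇ {(r , _) ∷ Δ} (one ∷ bs) | Γ , rs , ss , π = Γ , r ∷ rs , ss ,
    ↭-trans (prep _ π) (↭-sym (shift _ (◇S Γ) (ones rs ss)))
  extract-◇ {(r , _) ∷ Δ} (one̅ ∷ bs) | Γ , rs , ss , π = Γ , rs , r ∷ ss ,
    ↭-trans (prep _ π) (↭-sym (↭-trans (++⁺ˡ (◇S Γ) (shift _ (rs ∙ 𝟙) (ss ∙ 𝟙̄)))
      (shift _ (◇S Γ) (ones rs ss))))
  extract-◇ {(r , ◇ A) ∷ Δ} (dia ∷ bs) | Γ , rs , ss , π = (r , A) ∷ Γ , rs , ss , prep _ π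

  extract-ones : ∀ {Δ} → All OneW Δ → ∃ λ rs → ∃ λ ss → Δ ↭ ones rs ss
  extract-ones [] = [] , [] , ↭-refl
  extract-ones {(r , _) ∷ Δ} (b ∷ bs) with extract-ones bs
  extract-ones {(r , _) ∷ Δ} (𝟙 ∷ bs) | rs , ss , π = r ∷ rs , ss , prep _ π
  extract-ones {(r , _) ∷ Δ} (𝟙̄ ∷ bs) | rs , ss , π = rs , r ∷ ss ,
    ↭-trans (prep _ π) (↭-sym (shift _ (rs ∙ 𝟙) (ss ∙ 𝟙̄)))

  ones-≤ : ∀ Γ rs ss → lin ω Γ ≡ 0ℝ → 0ℝ ≤ lin ω (Γ ++ ones rs ss) → Σ⃗ ss ≤ Σ⃗ rs
  ones-≤ Γ rs ss z p = 0≤a-b⇒b≤a (subst (0ℝ ≤_) (trans (lin-++ ω Γ (ones rs ss))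
    (trans (cong₂ _+_ z (ω-ones rs ss)) (+-identityˡ _))) p)

  module _ {X : Sequent → Set} (laws : Laws X) (derive : ∀ {Γ} → X Γ → CANFree (Γ ∷ [])) where

    good-laws-≈ : ∀ {Γ Δ} → Γ ≈ Δ → Good X Γ → Good X Δ
    good-laws-≈ = Laws.resp-≈ (good-laws laws)

    -- Each descent is one instance of ID, its side condition being balance at that variable; the
    -- rest stays good because `undia` ignores variables. The bottom is a single instance of ◇.
    good-derivable : ∀ N {Δ} → All (BelowW N) Δ → Good X Δ → CANFree (Δ ∷ [])
    good-derivable zero bs g with extract-◇ bs
    ... | Γ , rs , ss , π with good-laws-≈ (perm π) g
    ... | (_ , o) , x = exS (↭-sym π) (DIA {Γ = Γ} rs ss
      (ones-≤ (◇S Γ) rs ss (lin-◇S ω (λ _ → refl) Γ) o)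
      (derive (subst X (trans (undia-++ (◇S Γ) (ones rs ss))
        (cong₂ _++_ (undia-◇S Γ) (undia-ones rs ss))) x)))
    good-derivable (suc N) {Δ} bs g with extract-vars N Δ bs
    ... | Θ , rs , ss , cs , π with good-laws-≈ (perm π) g
    ... | (v , o) , x = exS (↭-sym π) (ID N rs ss Σrs≡Σss (good-derivable N cs
      ( ( (λ y → trans (sym (drop-vars (χ y) (χ-odd y))) (v y))
        , subst (0ℝ ≤_) (drop-vars ω ω-odd) o)
      , subst X (trans (undia-++ Θ (vars N rs ss))
          (trans (cong (undia Θ ++_) (undia-vars N rs ss)) (++-identityʳ _))) x)))
      where
      Σrs≡Σss : Σ⃗ rs ≡ Σ⃗ ss
      Σrs≡Σss = a-b≡0⇒a≡b (trans (sym (+-identityˡ _)) (trans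
        (cong₂ _+_ (sym (lin-below cs)) (sym (lin-vars N rs ss)))
        (trans (sym (lin-++ (χ N) Θ (vars N rs ss))) (v N))))
      drop-vars : ∀ f → Odd f → lin f (Θ ++ vars N rs ss) ≡ lin f Θ
      drop-vars f odd = trans (lin-++ f Θ (vars N rs ss))
        (trans (cong (lin f Θ +_) (lin-balanced f odd rs ss (var N) Σrs≡Σss)) (+-identityʳ _))

  atoms-strat : ∀ {Γ} → All AtomW Γ → StratS Γ
  atoms-strat = All.map atom-strat

  AtomH : Hypersequent → Set
  AtomH = All (All AtomW)

  weaken : ∀ G {H} → CANFree H → CANFree (G ++ H)
  weaken []      d = d
  weaken (Γ ∷ G) d = W (weaken G d)

  -- A positive combination of the components is derived from them by S and T,
  -- the components of weight 0 being added by W.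
  collect : ∀ {G} → AtomH G → ∀ σ {m Δ} → at (H.⟪ G ⟫ σ) m Δ →
    (nothing ≡ m × [] ≈ Δ) ⊎
    (∃ λ Θ → Θ ≈ Δ × All AtomW Θ × (∀ H → CANFree (Θ ∷ H) → CANFree (G ++ H)))
  collect [] [] k = inj₁ k
  collect {Γ ∷ G} (as ∷ bs) (σ ∷ σs) (nothing , n , Δ₁ , Δ₂ , w , e , k , h)
    with collect bs σs h
  ... | inj₁ (w' , p) = inj₁ (trans w' w , ≈-trans (≈-++ (atoms-cone⁻¹ as σ nothing k) p) e)
  ... | inj₂ (Θ , p , cs , f) = inj₂ (Θ
    , ≈-trans p (≈-trans (≈-++ʳ Δ₂ (atoms-cone⁻¹ as σ nothing k)) e) , cs , λ H d → W (f H d))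
  collect {Γ ∷ G} (as ∷ bs) (σ ∷ σs) (just c , n , Δ₁ , Δ₂ , w , e , k , h)
    with collect bs σs h
  ... | inj₁ (_ , p) = inj₂ (scaleS c Γ
    , ≈-trans (≈-reflexive (sym (++-identityʳ _))) (≈-trans (≈-++ (atoms-cone⁻¹ as σ (just c) k) p) e)
    , All.map⁺ as , λ H d → exH (shift Γ G H) (weaken G (T c d)))
  ... | inj₂ (Θ , p , cs , f) = inj₂ (scaleS c Γ ++ Θ
    , ≈-trans (≈-++ (atoms-cone⁻¹ as σ (just c) k) p) e
    , All.++⁺ (All.map⁺ as) cs
    , λ H d → exH (shift Γ G H) (f (Γ ∷ H) (exH (swap _ _ ↭-refl) (T c (S d)))))

  -- Decomposition of valid hypersequents into atomic ones

  size : Term → ℕ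
  size (A ⊕ B) = suc (size A ℕ.+ size B)
  size (r ⊙ A) = suc (size A)
  size (A ⊔ B) = suc (size A ℕ.+ size B)
  size (A ⊓ B) = suc (size A ℕ.+ size B)
  size _       = 1

  sizeS : Sequent → ℕ
  sizeS []            = 0
  sizeS ((_ , A) ∷ Γ) = size A ℕ.+ sizeS Γ

  exS-last : ∀ {p Γ G} → CANFree ((Γ ++ p ∷ []) ∷ G) → CANFree ((p ∷ Γ) ∷ G)
  exS-last {p} {Γ} = exS (++-comm Γ (p ∷ []))

  exS-first : ∀ {p Γ G} → CANFree ((p ∷ Γ) ∷ G) → CANFree ((Γ ++ p ∷ []) ∷ G)
  exS-first {p} {Γ} = exS (++-comm (p ∷ []) Γ)

  module Decomposition (n : ℕ) where
    open Level n

    -- The hypothesis treats hypersequents in which the sequent at hand has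
    -- been replaced by atomic ones.
    decompose : ∀ k Γ {Δ G} → sizeS Γ ℕ.≤ k → All AtomW Δ → Valid n ((Γ ++ Δ) ∷ G) →
      (∀ As → AtomH As → Valid n (As ++ G) → CANFree (As ++ G)) → CANFree ((Γ ++ Δ) ∷ G)

    decompose-atom : ∀ k Γ {Δ G r A} → sizeS Γ ℕ.≤ k → Atom A → All AtomW Δ →
      Valid n (((r , A) ∷ Γ ++ Δ) ∷ G) →
      (∀ As → AtomH As → Valid n (As ++ G) → CANFree (As ++ G)) → CANFree (((r , A) ∷ Γ ++ Δ) ∷ G)
    decompose-atom k Γ {Δ} q a as v cont = exS (shift _ Γ Δ)
      (decompose k Γ q (a ∷ as) (valid-↭ (↭-sym (shift _ Γ Δ)) v) cont)

    decompose k       []                    q         as v cont = cont (_ ∷ []) (as ∷ []) v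
    decompose (suc k) ((r , var x) ∷ Γ)     (ℕ.s≤s q) as v cont = decompose-atom k Γ q (var x) as v cont
    decompose (suc k) ((r , covar x) ∷ Γ)   (ℕ.s≤s q) as v cont = decompose-atom k Γ q (covar x) as v cont
    decompose (suc k) ((r , 𝟙) ∷ Γ)         (ℕ.s≤s q) as v cont = decompose-atom k Γ q one as v cont
    decompose (suc k) ((r , 𝟙̄) ∷ Γ)         (ℕ.s≤s q) as v cont = decompose-atom k Γ q one̅ as v cont
    decompose (suc k) ((r , ◇ A) ∷ Γ)       (ℕ.s≤s q) as v cont = decompose-atom k Γ q (dia A) as v cont
    decompose (suc k) ((r , 𝟘) ∷ Γ)         (ℕ.s≤s q) as v cont =
      exS-last (ZERO (r ∷ []) (decompose k Γ q as (valid-𝟘⁻¹ v) cont))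
    decompose (suc k) ((r , A ⊕ B) ∷ Γ) {Δ} (ℕ.s≤s q) as v cont =
      exS-last (PLUS {A = A} {B} (r ∷ []) (exS (++-comm ((r , A) ∷ (r , B) ∷ []) (Γ ++ Δ))
        (decompose k ((r , A) ∷ (r , B) ∷ Γ)
          (subst (ℕ._≤ k) (ℕ.+-assoc (size A) (size B) (sizeS Γ)) q) as (valid-⊕⁻¹ v) cont)))
    decompose (suc k) ((r , s ⊙ A) ∷ Γ)     (ℕ.s≤s q) as v cont =
      exS-last (TIMES {A = A} s (r ∷ []) (exS-first
        (decompose k ((s ·ᵖ r , A) ∷ Γ) q as (valid-⊙⁻¹ v) cont)))
    decompose (suc k) ((r , A ⊔ B) ∷ Γ) {Δ} {G} (ℕ.s≤s q) as v cont =
      exS-last (JOIN {A = A} {B} (r ∷ []) (exS-first (exH (swap _ _ ↭-refl)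
        (exS-first (exH (swap _ _ ↭-refl)
          (decompose k ((r , A) ∷ Γ) (size-left A B Γ q) as (valid-⊔⁻¹ v) right))))))
      where
      size-left : ∀ A B Γ → size A ℕ.+ size B ℕ.+ sizeS Γ ℕ.≤ k → size A ℕ.+ sizeS Γ ℕ.≤ k
      size-left A B Γ = ℕ.≤-trans (ℕ.+-monoˡ-≤ (sizeS Γ) (ℕ.m≤m+n (size A) (size B)))
      -- ⊔ duplicates Γ, so the hypersequent as a whole need not shrink. Each of the two components
      -- does, so the second is left to the continuation of the first and the recursion measures a
      -- single sequent.
      right : ∀ As → AtomH As → Valid n (As ++ ((r , B) ∷ Γ ++ Δ) ∷ G) →
        CANFree (As ++ ((r , B) ∷ Γ ++ Δ) ∷ G)
      right As bs w = exH (↭-sym (shift _ As G)) (decompose k ((r , B) ∷ Γ)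
        (ℕ.≤-trans (ℕ.+-monoˡ-≤ (sizeS Γ) (ℕ.m≤n+m (size B) (size A))) q) as
        (valid-↭ᴴ (shift _ As G) w)
        (λ Bs cs u → subst CANFree (++-assoc Bs As G)
          (cont (Bs ++ As) (All.++⁺ cs bs) (subst (Valid n) (sym (++-assoc Bs As G)) u))))
    decompose (suc k) ((r , A ⊓ B) ∷ Γ)     (ℕ.s≤s q) as v cont =
      exS-last (MEET {A = A} {B} (r ∷ [])
        (exS-first (decompose k ((r , A) ∷ Γ)
          (ℕ.≤-trans (ℕ.+-monoˡ-≤ (sizeS Γ) (ℕ.m≤m+n (size A) (size B))) q) as (valid-⊓⁻¹₁ v) cont))
        (exS-first (decompose k ((r , B) ∷ Γ)
          (ℕ.≤-trans (ℕ.+-monoˡ-≤ (sizeS Γ) (ℕ.m≤n+m (size B) (size A))) q) as (valid-⊓⁻¹₂ v) cont)))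

    decompose-all : (∀ {G} → AtomH G → Valid n G → CANFree G) →
      ∀ G {As} → AtomH As → Valid n (G ++ As) → CANFree (G ++ As)
    decompose-all atomic [] as v = atomic as v
    decompose-all atomic (Γ ∷ G) {As} as v =
      subst (λ Γ → CANFree (Γ ∷ G ++ As)) (++-identityʳ Γ)
        (decompose (sizeS Γ) Γ ℕ.≤-refl []
          (subst (λ Γ → Valid n (Γ ∷ G ++ As)) (sym (++-identityʳ Γ)) v)
          λ Bs bs w → exH (shifts G Bs) (decompose-all atomic G (All.++⁺ bs as) (valid-↭ᴴ (shifts Bs G) w)))

  -- Induction on the level: the good sequent behind an atomic hypersequent needs its ◇ premise
  -- derived, which is completeness one level down, or rule 1 from INIT on level 0.
  completeness : ∀ n G → Valid n G → CANFree G

  premise-derivable : ∀ n {Γ} → Premise n Γ → CANFree (Γ ∷ [])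
  premise-derivable zero (as , (_ , o)) with extract-ones as
  ... | rs , ss , π = exS (↭-sym π) (ONE rs ss
    (ones-≤ [] rs ss refl (subst (0ℝ ≤_) (lin-↭ ω π) o)) INIT)
  premise-derivable (suc n) v = completeness n _ v

  atoms-completeness : ∀ n {G} → AtomH G → Valid n G → CANFree G
  atoms-completeness n {G} as v with v (All.map atoms-strat as)
  ... | r , Δ , k , g with collect as (All.map atoms-strat as) k
  -- The other case of `collect` would give the witness weight 0, but its weight is positive.
  ... | inj₂ (Θ , p , bs , f) = subst CANFree (++-identityʳ G)
    (f [] (good-derivable (premise-laws n) (premise-derivable n) _ (proj₂ (atoms-below bs))
      (Laws.resp-≈ (good-laws (premise-laws n)) (≈-sym p) g)))

  completeness n G v = subst CANFree (++-identityʳ G)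
    (Decomposition.decompose-all n (atoms-completeness n) G []
      (subst (Valid n) (sym (++-identityʳ G)) v))

theorem4p12 : (R : Reals) (G : HMR.Hypersequent R) →
    HMR.Derivable R G → HMR.CANFreeDerivable R G
theorem4p12 R G d with CANElimination.soundness R d
... | N , v = CANElimination.completeness R N G (v N ℕ.≤-refl)
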